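{- Let $G$ be a cubic (i.e. $3$-regular) graph on $n$ vertices, and let $s=\lceil (n+3)/4\rceil$. Then $\operatorname{tvs}(G)=s$. Moreover, $G$ has a vertex irregular total $s$-labeling in which every edge receives label $1$ or $s$.
   Context: All graphs are finite and simple, and need not be connected. For a positive integer $k$, a total $k$-labeling of a graph $G$ is a mapping $\lambda:V(G)\cup E(G)\to\{1,\ldots,k\}$. The weight of a vertex $v$ under $\lambda$ is $\operatorname{wt}_\lambda(v)=\lambda(v)+\sum_{e\ni v}\lambda(e)$, the sum being over the edges $e$ of $G$ incident with $v$. The labeling $\lambda$ is vertex irregular if $\operatorname{wt}_\lambda(u)\ne\operatorname{wt}_\lambda(v)$ for any two distinct vertices $u,v\in V(G)$. The total vertex irregularity strength $\operatorname{tvs}(G)$ is the smallest positive integer $k$ for which $G$ has a vertex irregular total $k$-labeling. -}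

module Defs where

open import Data.Fin using (Fin)
open import Data.Fin.Subset using (Subset; ∣_∣)
open import Data.Fin.Subset.Properties using (_∈?_)
open import Data.List using (List; allFin; filter; length; map)
open import Data.Nat using (ℕ; _+_; _≤_; _/_; pred; NonZero)
open import Data.Nat.ListAction using (sum)
open import Data.Product using (Σ-syntax; _×_)
open import Data.Sum using (_⊎_; inj₁; inj₂)
open import Function.Definitions using (Injective)
open import Relation.Binary.PropositionalEquality using (_≡_; _≢_)

⌈_/_⌉ : (a b : ℕ) .{{_ : NonZero b}} → ℕ
⌈ a / b ⌉ = (a + pred b) / b

-- A finite simple graph: the edges are 2-element sets of vertices, enumerated
-- without repetition.  Having exactly two ends rules out loops, and
-- injectivity rules out parallel edges.
record Graph : Set where
  field
    order          : ℕ
    size           : ℕ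
    ends           : Fin size → Subset order
    two-ends       : ∀ e → ∣ ends e ∣ ≡ 2
    ends-injective : Injective _≡_ _≡_ ends

V : Graph → Set
V G = Fin (Graph.order G)

E : Graph → Set
E G = Fin (Graph.size G)

incidentEdges : (G : Graph) → V G → List (E G)
incidentEdges G v = filter (λ e → v ∈? ends e) (allFin size)
  where open Graph G

degree : (G : Graph) → V G → ℕ
degree G v = length (incidentEdges G v)

Cubic : Graph → Set
Cubic G = ∀ v → degree G v ≡ 3

record TotalLabeling (G : Graph) (k : ℕ) : Set where
  field
    label     : V G ⊎ E G → ℕ
    label-pos : ∀ x → 1 ≤ label x
    label-≤   : ∀ x → label x ≤ k

  vertexLabel : V G → ℕ
  vertexLabel v = label (inj₁ v)

  edgeLabel : E G → ℕ
  edgeLabel e = label (inj₂ e)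

  weight : V G → ℕ
  weight v = vertexLabel v + sum (map edgeLabel (incidentEdges G v))

open TotalLabeling public using (edgeLabel; weight)

VertexIrregular : {G : Graph} {k : ℕ} → TotalLabeling G k → Set
VertexIrregular {G} ℓ = (u v : V G) → u ≢ v → weight ℓ u ≢ weight ℓ v

HasVertexIrregularLabeling : Graph → ℕ → Set
HasVertexIrregularLabeling G k = Σ[ ℓ ∈ TotalLabeling G k ] VertexIrregular ℓ

-- `IsTvs G k` says tvs(G) = k.  By antisymmetry of _≤_ at most one k
-- satisfies it.
IsTvs : Graph → ℕ → Set
IsTvs G k =
  1 ≤ k
  × HasVertexIrregularLabeling G k
  × (∀ j → 1 ≤ j → HasVertexIrregularLabeling G j → k ≤ j)

{-# OPTIONS --safe #-}

-- Label every edge 1 or s, let H be the set of edges labelled s, and put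
-- t = s − 1.  A vertex of H-degree k can be given any weight 4 + p with
-- k t ≤ p ≤ (k + 1) t.  Filling these four intervals greedily produces distinct
-- weights as soon as any ℓ consecutive degree classes have together at most
-- ℓ t + 1 vertices.
--
-- Such an H is found by local search.  Let n = 2 N and let n_k be the number of
-- vertices of H-degree k; the n_k are determined by N, u = n₀ − n₃,
-- v = n₀ + n₁ − N and w = n₁ + n₂ − N.  Edges at a single vertex are flipped as
-- long as this lowers a potential of (u , v , w).  That the search stops only at
-- a suitable H is a discharging argument: vertices receive a charge depending on
-- their degree and pass on amounts along the edges, so that the total is a
-- linear form in (u , v , w).  When this form is negative, some vertex has
-- negative charge, and each such vertex admits one of finitely many prescribed
-- moves.  Fourteen rules of this kind (Farkas certificates of the linear program
-- counting local configurations) cover all (u , v , w); since the potential is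
-- linear far from the origin in every coordinate, this is a finite check.
--
-- Conversely, weights lie between 4 and 4 k, so 4 k − 3 ≥ n.
module Submission where

open import Defs
open import Data.Bool using (Bool; true; false; if_then_else_; _xor_)
open import Data.Fin using (Fin; zero; suc; cast; toℕ; fromℕ<)
open import Data.Fin.Patterns
import Data.Fin.Properties as Fin
open import Data.Fin.Subset using (Subset; inside; outside; _∈_; _∉_) renaming (∣_∣ to ∣_∣ˢ)
open import Data.Fin.Subset.Properties using (_∈?_; ⊆-antisym)
open import Data.Integer using (ℤ; +_; -[1+_]; +[1+_]; 0ℤ; -1ℤ; ∣_∣; +≤+; -≤-; +<+; nonNegative; nonPositive)
  renaming ( _+_ to _+ᶻ_; _*_ to _*ᶻ_; _-_ to _-ᶻ_; -_ to -ᶻ_; _≤_ to _≤ᶻ_; _<_ to _<ᶻ_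
           ; _≤?_ to _≤ᶻ?_; _<?_ to _<ᶻ?_)
import Data.Integer as ℤ
import Data.Integer.Properties as ℤ
import Data.Integer.Tactic.RingSolver as ℤ-Solver
open import Data.List using (List; []; _∷_; _++_; allFin; filter; length; lookup; map; tabulate)
open import Data.List.Membership.Propositional using (find) renaming (_∈_ to _∈ᴸ_)
open import Data.List.Membership.Propositional.Properties
  using (∈-filter⁺; ∈-filter⁻; ∈-lookup; ∈-allFin)
open import Data.List.Relation.Unary.All using (All; all?)
import Data.List.Relation.Unary.All as All
open import Data.List.Relation.Unary.AllPairs using (_∷_)
open import Data.List.Relation.Unary.Any using (Any; any?; here; there; index)
open import Data.List.Relation.Unary.Any.Properties using (lookup-index)
open import Data.List.Relation.Unary.Unique.Propositional using (Unique)
import Data.List.Relation.Unary.Unique.Propositional.Properties as Unique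
open import Data.Nat
  using ( ℕ; zero; suc; _+_; _*_; _∸_; _⊔_; _/_; _%_; _≤_; _<_; z≤n; s≤s; s≤s⁻¹; _≤?_; _<?_; _≟_)
open import Data.Nat.Divisibility using (∣-refl)
open import Data.Nat.DivMod using (m≡m%n+[m/n]*n; m%n<n; m*n%n≡0; +-distrib-/-∣ʳ; m<n*o⇒m/o<n)
open import Data.Nat.Induction using (Acc; acc; <-wellFounded)
import Data.Nat.ListAction as List
import Data.Nat.Properties as ℕ
import Data.Nat.Tactic.RingSolver as ℕ-Solver
open import Data.Product using (Σ-syntax; ∃; ∃-syntax; _×_; _,_; proj₁; proj₂)
open import Data.Product.Properties using (≡-dec)
open import Data.Sum using (_⊎_; inj₁; inj₂; [_,_]′)
open import Data.Vec using ([]; _∷_)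
open import Function using (_∘_; id)
open import Function.Definitions using (Injective)
open import Level using (0ℓ)
open import Relation.Binary.Definitions using (tri<; tri≈; tri>)
open import Relation.Binary.PropositionalEquality
open import Relation.Nullary using (Dec; yes; no; does; contradiction)
open import Relation.Nullary.Decidable
  using (_×-dec_; _⊎-dec_; _→-dec_; ¬?; dec-true; dec-false; map′; toWitness)
open import Relation.Unary using (Pred; Decidable)

open import Algebra.Properties.CommutativeMonoid.Sum ℤ.+-0-commutativeMonoid
  using (sum; sum-cong-≗; sum-replicate-zero; ∑-comm; ∑-distrib-+)
open import Algebra.Properties.Semiring.Sum ℤ.+-*-semiring using (*-distribˡ-sum)

-- Finite sums

private variable
  k m n : ℕ

sum-zero : {f : Fin n → ℤ} → (∀ i → f i ≡ 0ℤ) → sum f ≡ 0ℤ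
sum-zero {n} f≡0 = trans (sum-cong-≗ f≡0) (sum-replicate-zero n)

sum-point : ∀ (j : Fin n) (f : Fin n → ℤ) →
  sum (λ i → if does (j Fin.≟ i) then f i else 0ℤ) ≡ f j
sum-point {suc n} zero f = trans (cong (f zero +ᶻ_) (sum-replicate-zero n)) (ℤ.+-identityʳ _)
sum-point (suc j) f = trans (ℤ.+-identityˡ _) (sum-point j (f ∘ suc))

-- By injectivity every point of the image has exactly one index, so `f` is a sum of point masses
-- indexed by `Fin k` and the two summations can be exchanged.
sum-supported : (p : Fin k → Fin n) → Injective _≡_ _≡_ p → (f : Fin n → ℤ) →
  (∀ x → (∀ i → p i ≢ x) → f x ≡ 0ℤ) → sum f ≡ sum (f ∘ p)
sum-supported {k} {n} p p-inj f f≡0 = begin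
  sum f                                ≡⟨ sum-cong-≗ split ⟩
  sum (λ x → sum (λ i → hit i x))      ≡⟨ ∑-comm (λ x i → hit i x) ⟩
  sum (λ i → sum (λ x → hit i x))      ≡⟨ sum-cong-≗ (λ i → sum-point (p i) f) ⟩
  sum (f ∘ p)                          ∎
  where
  open ≡-Reasoning
  hit : Fin k → Fin n → ℤ
  hit i x = if does (p i Fin.≟ x) then f x else 0ℤ

  hit-image : ∀ j i → hit i (p j) ≡ (if does (j Fin.≟ i) then f (p j) else 0ℤ)
  hit-image j i with j Fin.≟ i
  ... | yes refl rewrite dec-true (p j Fin.≟ p j) refl = refl
  ... | no j≢i rewrite dec-false (p i Fin.≟ p j) (j≢i ∘ sym ∘ p-inj) = refl

  split : ∀ x → f x ≡ sum (λ i → hit i x)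
  split x with Fin.any? (λ i → p i Fin.≟ x)
  ... | yes (j , refl) =
    sym (trans (sum-cong-≗ (hit-image j)) (sum-point j (λ _ → f (p j))))
  ... | no ∄i = trans (f≡0 x λ i eq → ∄i (i , eq)) (sym (sum-zero miss))
    where
    miss : ∀ i → hit i x ≡ 0ℤ
    miss i rewrite dec-false (p i Fin.≟ x) (λ eq → ∄i (i , eq)) = refl

lookup-injective : ∀ {A : Set} {xs : List A} → Unique xs → Injective _≡_ _≡_ (lookup xs)
lookup-injective (_ ∷ _)    {zero}  {zero}  _  = refl
lookup-injective (x∉ ∷ _)   {zero}  {suc j} eq = contradiction eq (All.lookup x∉ (∈-lookup j))
lookup-injective (x∉ ∷ _)   {suc i} {zero}  eq = contradiction (sym eq) (All.lookup x∉ (∈-lookup i))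
lookup-injective (_ ∷ uniq) {suc i} {suc j} eq = cong suc (lookup-injective uniq eq)

-- Gives the three edges at a vertex and the two ends of an edge fixed indices, so that local
-- configurations become functions on `Fin 3`.
record Enumeration {n} (P : Pred (Fin n) 0ℓ) (k : ℕ) : Set where
  field
    at        : Fin k → Fin n
    injective : Injective _≡_ _≡_ at
    sound     : ∀ i → P (at i)
    locate    : ∀ x → P x → ∃[ i ] at i ≡ x

  sum-at : (P? : Decidable P) (f : Fin n → ℤ) →
    sum (λ x → if does (P? x) then f x else 0ℤ) ≡ sum (f ∘ at)
  sum-at P? f = trans (sum-supported at injective _ miss) (sum-cong-≗ hit)
    where
    miss : ∀ x → (∀ i → at i ≢ x) → (if does (P? x) then f x else 0ℤ) ≡ 0ℤ
    miss x x∉ with P? x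
    ... | yes px = contradiction (proj₂ (locate x px)) (x∉ _)
    ... | no  _  = refl
    hit : ∀ i → (if does (P? (at i)) then f (at i) else 0ℤ) ≡ f (at i)
    hit i rewrite dec-true (P? (at i)) (sound i) = refl

enumerate : ∀ {P : Pred (Fin n) 0ℓ} (P? : Decidable P) →
  length (filter P? (allFin n)) ≡ k → Enumeration P k
enumerate {n} P? len = record
  { at        = lookup xs ∘ cast (sym len)
  ; injective = λ eq → cast-injective (lookup-injective (Unique.filter⁺ P? (Unique.allFin⁺ n)) eq)
  ; sound     = λ i → proj₂ (∈-filter⁻ P? {xs = allFin n} (∈-lookup (cast (sym len) i)))
  ; locate    = λ x px → let x∈ = ∈-filter⁺ P? (∈-allFin x) px in
      cast len (index x∈) ,
      trans (cong (lookup xs) (Fin.cast-involutive (sym len) len (index x∈))) (sym (lookup-index x∈))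
  }
  where
  xs = filter P? (allFin n)
  cast-injective : ∀ {i j} → cast (sym len) i ≡ cast (sym len) j → i ≡ j
  cast-injective {i} {j} eq =
    trans (sym (Fin.cast-involutive len (sym len) i))
      (trans (cong (cast len) eq) (Fin.cast-involutive len (sym len) j))

length-filter-cong : ∀ {A B : Set} {P : Pred A 0ℓ} {Q : Pred B 0ℓ}
  (P? : Decidable P) (Q? : Decidable Q) (f : Fin n → A) (g : Fin n → B) →
  (∀ i → does (P? (f i)) ≡ does (Q? (g i))) →
  length (filter P? (tabulate f)) ≡ length (filter Q? (tabulate g))
length-filter-cong {zero}  P? Q? f g eq = refl
length-filter-cong {suc n} P? Q? f g eq
  with does (P? (f zero)) | does (Q? (g zero)) | eq zero
... | true  | _ | refl = cong suc (length-filter-cong P? Q? (f ∘ suc) (g ∘ suc) (eq ∘ suc))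
... | false | _ | refl = length-filter-cong P? Q? (f ∘ suc) (g ∘ suc) (eq ∘ suc)

length-members : (p : Subset n) → length (filter (_∈? p) (allFin n)) ≡ ∣ p ∣ˢ
length-members []            = refl
length-members (inside  ∷ p) = cong suc
  (trans (length-filter-cong (_∈? (inside ∷ p)) (_∈? p) suc id (λ _ → refl)) (length-members p))
length-members (outside ∷ p) =
  trans (length-filter-cong (_∈? (outside ∷ p)) (_∈? p) suc id (λ _ → refl)) (length-members p)

-- Edge sets of a cubic graph

bit : Bool → ℕ
bit true  = 1
bit false = 0

two : Bool → Bool → Fin 3
two true  true  = 2F
two true  false = 1F
two false true  = 1F
two false false = 0F

total : (Fin 3 → Bool) → ℕ
total h = bit (h 0F) + bit (h 1F) + bit (h 2F)

-- Leaving out the `i`-th edge makes this count invariant when that edge is flipped.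
rest : (Fin 3 → Bool) → Fin 3 → Fin 3
rest h 0F = two (h 1F) (h 2F)
rest h 1F = two (h 0F) (h 2F)
rest h 2F = two (h 0F) (h 1F)

toℕ-two : ∀ x y → toℕ (two x y) ≡ bit x + bit y
toℕ-two true  true  = refl
toℕ-two true  false = refl
toℕ-two false true  = refl
toℕ-two false false = refl

total-rest : ∀ h i → total h ≡ bit (h i) + toℕ (rest h i)
total-rest h 0F rewrite toℕ-two (h 1F) (h 2F) = ℕ.+-assoc (bit (h 0F)) (bit (h 1F)) (bit (h 2F))
total-rest h 1F rewrite toℕ-two (h 0F) (h 2F) = swap (bit (h 0F)) (bit (h 1F)) (bit (h 2F))
  where
  swap : ∀ x y z → x + y + z ≡ y + (x + z)
  swap = ℕ-Solver.solve-∀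
total-rest h 2F rewrite toℕ-two (h 0F) (h 1F) = ℕ.+-comm (bit (h 0F) + bit (h 1F)) (bit (h 2F))

total-cong : ∀ {h h′} → (∀ i → h i ≡ h′ i) → total h ≡ total h′
total-cong h≗ = cong₂ _+_ (cong₂ _+_ (cong bit (h≗ 0F)) (cong bit (h≗ 1F))) (cong bit (h≗ 2F))

rest-cong : ∀ {h h′} i → (∀ j → j ≢ i → h j ≡ h′ j) → rest h i ≡ rest h′ i
rest-cong 0F h≗ = cong₂ two (h≗ 1F λ ()) (h≗ 2F λ ())
rest-cong 1F h≗ = cong₂ two (h≗ 0F λ ()) (h≗ 2F λ ())
rest-cong 2F h≗ = cong₂ two (h≗ 0F λ ()) (h≗ 1F λ ())

-- The change of Σ X(deg) when the edges at a vertex c selected by s are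
-- flipped; h records which edges at c lie in H, and r i is the number of
-- H-edges at the i-th neighbour of c other than the one joining it to c.
shift : (ℕ → ℤ) → (h : Fin 3 → Bool) (r : Fin 3 → Fin 3) (s : Fin 3 → Bool) → ℤ
shift X h r s =
  (X (total (λ i → h i xor s i)) -ᶻ X (total h)) +ᶻ
  sum (λ i → X (bit (h i xor s i) + toℕ (r i)) -ᶻ X (bit (h i) + toℕ (r i)))

module CubicGraph (G : Graph) (cubic : Cubic G) where
  open Graph G

  star : ∀ v → Enumeration (λ e → v ∈ ends e) 3
  star v = enumerate (λ e → v ∈? ends e) (cubic v)

  tips : ∀ e → Enumeration (_∈ ends e) 2
  tips e = enumerate (_∈? ends e) (trans (length-members (ends e)) (two-ends e))

  module Star v = Enumeration (star v)
  module Tips e = Enumeration (tips e)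

  edge : V G → Fin 3 → E G
  edge = Star.at

  tip : E G → Fin 2 → V G
  tip = Tips.at

  double-count : (F : V G → E G → ℤ) →
    sum (λ v → sum (λ i → F v (edge v i))) ≡ sum (λ e → F (tip e 0F) e +ᶻ F (tip e 1F) e)
  double-count F = begin
    sum (λ v → sum (λ i → F v (edge v i)))
      ≡⟨ sum-cong-≗ (λ v → Star.sum-at v (λ e → v ∈? ends e) (F v)) ⟨
    sum (λ v → sum (λ e → at v e))
      ≡⟨ ∑-comm at ⟩
    sum (λ e → sum (λ v → at v e))
      ≡⟨ sum-cong-≗ (λ e → Tips.sum-at e (_∈? ends e) (λ v → F v e)) ⟩
    sum (λ e → sum (λ j → F (tip e j) e))
      ≡⟨ sum-cong-≗ (λ e → cong (F (tip e 0F) e +ᶻ_) (ℤ.+-identityʳ _)) ⟩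
    sum (λ e → F (tip e 0F) e +ᶻ F (tip e 1F) e) ∎
    where
    open ≡-Reasoning
    at : V G → E G → ℤ
    at v e = if does (v ∈? ends e) then F v e else 0ℤ

  -- For `v` outside `e` the value defaults to `tip e 0F`, an end of `e` different from `v`.
  other : V G → E G → V G
  other v e = if does (tip e 0F Fin.≟ v) then tip e 1F else tip e 0F

  tips-distinct : ∀ e → tip e 0F ≢ tip e 1F
  tips-distinct e eq with () ← Tips.injective e eq

  other-0 : ∀ e → other (tip e 0F) e ≡ tip e 1F
  other-0 e rewrite dec-true (tip e 0F Fin.≟ tip e 0F) refl = refl

  other-1 : ∀ e → other (tip e 1F) e ≡ tip e 0F
  other-1 e rewrite dec-false (tip e 0F Fin.≟ tip e 1F) (tips-distinct e) = refl

  other-∈ : ∀ v e → other v e ∈ ends e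
  other-∈ v e with does (tip e 0F Fin.≟ v)
  ... | true  = Tips.sound e 1F
  ... | false = Tips.sound e 0F

  other-≢ : ∀ v e → other v e ≢ v
  other-≢ v e with tip e 0F Fin.≟ v
  ... | yes refl = tips-distinct e ∘ sym
  ... | no  ≢v   = ≢v

  other-unique : ∀ {v x e} → v ∈ ends e → x ∈ ends e → x ≢ v → other v e ≡ x
  other-unique {v} {x} {e} v∈ x∈ x≢v with Tips.locate e v v∈ | Tips.locate e x x∈
  ... | 0F , refl | 0F , refl = contradiction refl x≢v
  ... | 0F , refl | 1F , refl = other-0 e
  ... | 1F , refl | 0F , refl = other-1 e
  ... | 1F , refl | 1F , refl = contradiction refl x≢v

  nbr : V G → Fin 3 → V G
  nbr v i = other v (edge v i)

  -- This is how `ends-injective` gets applied: two edges at `v` with a common far end contain each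
  -- other, hence coincide.
  ends-⊆ : ∀ {v e f} → v ∈ ends e → v ∈ ends f → other v e ≡ other v f →
    ∀ {x} → x ∈ ends e → x ∈ ends f
  ends-⊆ {v} {e} {f} v∈e v∈f eq {x} x∈e with x Fin.≟ v
  ... | yes refl = v∈f
  ... | no  x≢v  = subst (_∈ ends f) (trans (sym eq) (other-unique v∈e x∈e x≢v)) (other-∈ v f)

  nbr-injective : ∀ v → Injective _≡_ _≡_ (nbr v)
  nbr-injective v {i} {j} eq = Star.injective v (ends-injective
    (⊆-antisym (ends-⊆ (Star.sound v i) (Star.sound v j) eq)
               (ends-⊆ (Star.sound v j) (Star.sound v i) (sym eq))))

  position : V G → E G → Fin 3
  position v e with v ∈? ends e
  ... | yes v∈e = proj₁ (Star.locate v e v∈e)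
  ... | no  _   = 0F

  edge-position : ∀ {v e} → v ∈ ends e → edge v (position v e) ≡ e
  edge-position {v} {e} v∈e with v ∈? ends e
  ... | yes p  = proj₂ (Star.locate v e p)
  ... | no  ∉e = contradiction v∈e ∉e

  position-edge : ∀ v i → position v (edge v i) ≡ i
  position-edge v i = Star.injective v (edge-position (Star.sound v i))

  deg : (E G → Bool) → V G → ℕ
  deg H v = total (H ∘ edge v)

  res : (E G → Bool) → V G → E G → Fin 3
  res H v e = rest (H ∘ edge v) (position v e)

  deg-res : ∀ H {v e} → v ∈ ends e → deg H v ≡ bit (H e) + toℕ (res H v e)
  deg-res H {v} {e} v∈e = trans (total-rest (H ∘ edge v) (position v e))
    (cong (λ f → bit (H f) + toℕ (res H v e)) (edge-position v∈e))

  flip : V G → (Fin 3 → Bool) → (E G → Bool) → E G → Bool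
  flip c s H e = if does (c ∈? ends e) then H e xor s (position c e) else H e

  flip-at : ∀ c s H i → flip c s H (edge c i) ≡ H (edge c i) xor s i
  flip-at c s H i rewrite dec-true (c ∈? ends (edge c i)) (Star.sound c i) | position-edge c i = refl

  flip-off : ∀ {c} s H {e} → c ∉ ends e → flip c s H e ≡ H e
  flip-off {c} s H {e} c∉e rewrite dec-false (c ∈? ends e) c∉e = refl

  stat : (ℕ → ℤ) → (E G → Bool) → ℤ
  stat X H = sum (X ∘ deg H)

  module _ (c : V G) (s : Fin 3 → Bool) (H : E G → Bool) where
    private H′ = flip c s H

    deg-flip-centre : deg H′ c ≡ total (λ i → H (edge c i) xor s i)
    deg-flip-centre = total-cong (flip-at c s H)

    -- Among the edges at a neighbour only the one to `c` is flipped: a second one containing `c`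
    -- would be parallel to it.
    deg-flip-nbr : ∀ i → deg H′ (nbr c i) ≡ bit (H (edge c i) xor s i) + toℕ (res H (nbr c i) (edge c i))
    deg-flip-nbr i = trans (deg-res H′ w∈e) (cong₂ (λ b r → bit b + toℕ r) (flip-at c s H i)
      (rest-cong (position w e) λ j j≢ → flip-off s H (unaffected j j≢)))
      where
      e = edge c i
      w = nbr c i
      w∈e : w ∈ ends e
      w∈e = other-∈ c e
      unaffected : ∀ j → j ≢ position w e → c ∉ ends (edge w j)
      unaffected j j≢ c∈ = j≢ (Star.injective w (trans (ends-injective (⊆-antisym
          (ends-⊆ (Star.sound w j) w∈e same) (ends-⊆ w∈e (Star.sound w j) (sym same))))
          (sym (edge-position w∈e))))
        where
        c≢w : c ≢ w
        c≢w = other-≢ c e ∘ sym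
        same : other w (edge w j) ≡ other w e
        same = trans (other-unique (Star.sound w j) c∈ c≢w)
                     (sym (other-unique w∈e (Star.sound c i) c≢w))

    deg-flip-far : ∀ {x} → x ≢ c → (∀ i → nbr c i ≢ x) → deg H′ x ≡ deg H x
    deg-flip-far {x} x≢c x≢nbr = total-cong λ j → flip-off s H λ c∈ →
      x≢nbr (position c (edge x j))
        (trans (cong (other c) (edge-position c∈)) (other-unique c∈ (Star.sound x j) x≢c))

    -- Only `c` and its neighbours change degree, and by simplicity they are four distinct vertices,
    -- so `sum-supported` reduces the change to `shift`.
    stat-flip : ∀ X → stat X H′ ≡
      stat X H +ᶻ shift X (H ∘ edge c) (λ i → res H (nbr c i) (edge c i)) s
    stat-flip X = begin
      sum (X ∘ deg H′)
        ≡⟨ sum-cong-≗ (λ x → undo (X (deg H′ x)) (X (deg H x))) ⟨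
      sum (λ x → X (deg H x) +ᶻ change x)
        ≡⟨ ∑-distrib-+ (X ∘ deg H) change ⟩
      stat X H +ᶻ sum change
        ≡⟨ cong (stat X H +ᶻ_) (sum-supported touched touched-injective change unchanged) ⟩
      stat X H +ᶻ (change c +ᶻ sum (change ∘ nbr c))
        ≡⟨ cong (stat X H +ᶻ_) (cong₂ _+ᶻ_
             (cong (λ d → X d -ᶻ X (deg H c)) deg-flip-centre)
             (sum-cong-≗ λ i → cong₂ (λ d d′ → X d -ᶻ X d′)
               (deg-flip-nbr i) (deg-res H (other-∈ c (edge c i))))) ⟩
      stat X H +ᶻ shift X (H ∘ edge c) (λ i → res H (nbr c i) (edge c i)) s ∎
      where
      open ≡-Reasoning
      change : V G → ℤ
      change x = X (deg H′ x) -ᶻ X (deg H x)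
      undo : ∀ a b → b +ᶻ (a -ᶻ b) ≡ a
      undo = ℤ-Solver.solve-∀
      touched : Fin 4 → V G
      touched 0F      = c
      touched (suc i) = nbr c i
      touched-injective : Injective _≡_ _≡_ touched
      touched-injective {0F}    {0F}    _  = refl
      touched-injective {0F}    {suc j} eq = contradiction (sym eq) (other-≢ c (edge c j))
      touched-injective {suc i} {0F}    eq = contradiction eq (other-≢ c (edge c i))
      touched-injective {suc i} {suc j} eq = cong suc (nbr-injective c eq)
      unchanged : ∀ x → (∀ i → touched i ≢ x) → change x ≡ 0ℤ
      unchanged x x∉ = trans
        (cong (λ d → X d -ᶻ X (deg H x)) (deg-flip-far (x∉ 0F ∘ sym) (x∉ ∘ suc)))
        (ℤ.+-inverseʳ (X (deg H x)))

-- Discharging rules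

-- Summed over the degrees these give n₀ - n₃, n₀ + n₁ and n₁ + n₂, that is u, v + N and w + N.
tilt low middle : ℕ → ℤ
tilt 0 = + 1
tilt 1 = + 0
tilt 2 = + 0
tilt _ = -1ℤ
low 0 = + 1
low 1 = + 1
low _ = + 0
middle 1 = + 1
middle 2 = + 1
middle _ = + 0

State : Set
State = ℤ × ℤ × ℤ

-- Along each edge outside (inside) H, the end meeting 0, 0, 1 other edges of H
-- receives the three amounts in absent (present) from the end meeting 1, 2, 2
-- other edges of H, respectively.
record Rule : Set where
  constructor rule
  field
    onTilt onLow onMiddle : ℤ
    absent present : ℤ × ℤ × ℤ
    moves : List State

open Rule

-- The rule obtained by complementing H, which reverses the degrees.
mirror : Rule → Rule
mirror (rule a b c (p , q , r) (p′ , q′ , r′) T) =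
  rule (-ᶻ a) (-ᶻ b) c (-ᶻ r′ , -ᶻ q′ , -ᶻ p′) (-ᶻ r , -ᶻ q , -ᶻ p)
       (map (λ (u , v , w) → -ᶻ u , -ᶻ v , w) T)

-- An antisymmetric matrix given by its entries above the diagonal: what one end receives, the other
-- pays.
transfer : ℤ × ℤ × ℤ → Fin 3 → Fin 3 → ℤ
transfer (p , q , r) 0F 1F = p
transfer (p , q , r) 0F 2F = q
transfer (p , q , r) 1F 2F = r
transfer (p , q , r) 1F 0F = -ᶻ p
transfer (p , q , r) 2F 0F = -ᶻ q
transfer (p , q , r) 2F 1F = -ᶻ r
transfer _           0F 0F = 0ℤ
transfer _           1F 1F = 0ℤ
transfer _           2F 2F = 0ℤ

flow : Rule → Bool → Fin 3 → Fin 3 → ℤ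
flow ρ false = transfer (absent ρ)
flow ρ true  = transfer (present ρ)

-- Since there are 2 N vertices, `+ 2 *ᶻ low k -ᶻ + 1` sums to 2 v and its analogue for `middle` to
-- 2 w, so the total weight is the form `linear ρ`.
weightOf : Rule → ℕ → ℤ
weightOf ρ k =
  onTilt ρ *ᶻ tilt k +ᶻ
  (onLow ρ *ᶻ (+ 2 *ᶻ low k -ᶻ + 1) +ᶻ onMiddle ρ *ᶻ (+ 2 *ᶻ middle k -ᶻ + 1))

charge : Rule → (Fin 3 → Bool) → (Fin 3 → Fin 3) → ℤ
charge ρ h r = weightOf ρ (total h) +ᶻ sum (λ i → flow ρ (h i) (rest h i) (r i))

displacement : (Fin 3 → Bool) → (Fin 3 → Fin 3) → (Fin 3 → Bool) → State
displacement h r s = shift tilt h r s , shift low h r s , shift middle h r s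

tri : ∀ {A : Set} → A → A → A → Fin 3 → A
tri x y z 0F = x
tri x y z 1F = y
tri x y z 2F = z

_≟ˢ_ : (x y : State) → Dec (x ≡ y)
_≟ˢ_ = ≡-dec ℤ._≟_ (≡-dec ℤ._≟_ ℤ._≟_)

bool∀? : ∀ {P : Bool → Set} → (∀ x → Dec (P x)) → Dec (∀ x → P x)
bool∀? P? = map′ (λ { (f , t) false → f ; (f , t) true → t }) (λ p → p false , p true)
  (P? false ×-dec P? true)

bool∃? : ∀ {P : Bool → Set} → (∀ x → Dec (P x)) → Dec (∃ P)
bool∃? P? = map′ (λ { (inj₁ f) → false , f ; (inj₂ t) → true , t })
  (λ { (false , p) → inj₁ p ; (true , p) → inj₂ p }) (P? false ⊎-dec P? true)

-- A vertex of negative charge must have a flip of its edges that realises one of the listed moves.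
-- Only its own edges and the residual degrees of its neighbours enter.
Discharged : Rule → (Fin 3 → Bool) → (Fin 3 → Fin 3) → Set
Discharged ρ h r = 0ℤ ≤ᶻ charge ρ h r ⊎
  (Σ[ s₀ ∈ Bool ] Σ[ s₁ ∈ Bool ] Σ[ s₂ ∈ Bool ] Any (displacement h r (tri s₀ s₁ s₂) ≡_) (moves ρ))

Valid : Rule → Set
Valid ρ = ∀ h₀ h₁ h₂ r₀ r₁ r₂ → Discharged ρ (tri h₀ h₁ h₂) (tri r₀ r₁ r₂)

-- `charge` and `displacement` evaluate `h` and `r` only at the three literal indices, so the case
-- of triples built by `tri` is the general case by computation.
discharged : ∀ {ρ} → Valid ρ → ∀ h r → Discharged ρ h r
discharged valid h r = valid (h 0F) (h 1F) (h 2F) (r 0F) (r 1F) (r 2F)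

valid? : ∀ ρ → Dec (Valid ρ)
valid? ρ = bool∀? λ h₀ → bool∀? λ h₁ → bool∀? λ h₂ →
  Fin.all? λ r₀ → Fin.all? λ r₁ → Fin.all? λ r₂ →
  let h = tri h₀ h₁ h₂ ; r = tri r₀ r₁ r₂ in
  (0ℤ ≤ᶻ? charge ρ h r) ⊎-dec
  (bool∃? λ s₀ → bool∃? λ s₁ → bool∃? λ s₂ → any? (displacement h r (tri s₀ s₁ s₂) ≟ˢ_) (moves ρ))

rules : List Rule
rules = base ++ map mirror base
  where
  base : List Rule
  base =
    rule (+ 0) -1ℤ -1ℤ (+ 0 , + 0 , + 0) (-[1+ 1 ] , + 2 , + 0)
      ((+ 1 , + 1 , -1ℤ) ∷ (+ 3 , + 1 , -1ℤ) ∷ (+ 2 , + 0 , -[1+ 1 ]) ∷ []) ∷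
    rule (+ 2) -1ℤ (+ 1) (+ 0 , + 0 , + 0) (+ 0 , -[1+ 1 ] , -1ℤ)
      ((+ 2 , + 0 , + 2) ∷ (+ 2 , + 0 , + 0) ∷ []) ∷
    rule (-[1+ 3 ]) (+ 3) -1ℤ (+ 0 , + 0 , + 0) (-[1+ 1 ] , -[1+ 1 ] , + 2)
      ((+ 0 , + 2 , + 0) ∷ (+ 1 , + 3 , + 1) ∷ []) ∷
    rule (+ 0) (+ 1) (+ 1) (+ 0 , + 0 , + 0) (-[1+ 1 ] , -[1+ 1 ] , -[1+ 1 ])
      ((+ 2 , + 0 , + 2) ∷ (+ 1 , + 1 , + 1) ∷ []) ∷
    rule (+ 0) (+ 3) (-[1+ 2 ]) (-[1+ 1 ] , -[1+ 1 ] , -[1+ 5 ]) (-[1+ 5 ] , -[1+ 5 ] , -[1+ 5 ])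
      ((+ 2 , + 0 , -[1+ 1 ]) ∷ (+ 1 , + 3 , -1ℤ) ∷ (+ 2 , + 0 , + 0) ∷ (+ 1 , + 1 , -1ℤ) ∷ (+ 1 , + 1 , + 1) ∷ []) ∷
    rule (+ 2) (-[1+ 1 ]) (+ 0) (+ 0 , + 0 , -[1+ 1 ]) (-[1+ 1 ] , -[1+ 1 ] , -1ℤ)
      ((+ 1 , + 1 , -1ℤ) ∷ (+ 2 , + 0 , -[1+ 1 ]) ∷ (+ 2 , + 0 , + 0) ∷ []) ∷
    rule (+ 0) (-[1+ 2 ]) (-[1+ 14 ]) (-[1+ 3 ] , + 0 , + 0) (-[1+ 11 ] , + 18 , + 6)
      ((+ 2 , + 0 , -[1+ 1 ]) ∷ (+ 1 , + 3 , -1ℤ) ∷ (+ 1 , + 1 , -1ℤ) ∷ (+ 3 , + 1 , -1ℤ) ∷ (+ 2 , + 2 , + 0) ∷ []) ∷ []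

abstract
  -- Evaluates all 8 · 27 local configurations for each of the fourteen rules.
  rules-valid : All Valid rules
  rules-valid = toWitness {a? = all? valid? rules} _

-- The potential

-- Affine on each side of 0, with a separate value at 0; far from 0, differences along a short move
-- depend only on the side.
wedge : (z p q p′ q′ : ℕ) → ℤ → ℕ
wedge z p q p′ q′ (+ 0)      = z
wedge z p q p′ q′ +[1+ m ]   = p + q * m
wedge z p q p′ q′ -[1+ m ]   = p′ + q′ * m

sgn : ℤ → ℤ
sgn (+ 0)    = + 0
sgn +[1+ _ ] = + 1
sgn -[1+ _ ] = -1ℤ

-- The constants come from a computer search for a potential with few rules.
height₁ height₂ height₃ : ℤ → ℕ
height₁ = wedge 0 1 5 1 5
height₂ = wedge 0 2 6 2 6
height₃ = wedge 3 5 10 0 6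

-- Couples u and v: 0 for equal nonzero signs, 4 if one of them vanishes, 8 for opposite signs.
twist : ℤ → ℤ → ℕ
twist σ τ = 4 * ∣ + 1 -ᶻ σ *ᶻ τ ∣

potential : State → ℕ
potential (u , v , w) = height₁ u + height₂ v + height₃ w + twist (sgn u) (sgn v)

_⊞_ : State → State → State
(u , v , w) ⊞ (u′ , v′ , w′) = u +ᶻ u′ , v +ᶻ v′ , w +ᶻ w′

linear : Rule → State → ℤ
linear ρ (u , v , w) = onTilt ρ *ᶻ u +ᶻ + 2 *ᶻ (onLow ρ *ᶻ v +ᶻ onMiddle ρ *ᶻ w)

-- Component k is 2 n_k - N, rewritten in u, v and w.
excess : State → Fin 4 → ℤ
excess (u , v , w) 0F = u -ᶻ w
excess (u , v , w) 1F = + 2 *ᶻ v +ᶻ w -ᶻ u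
excess (u , v , w) 2F = w -ᶻ + 2 *ᶻ v +ᶻ u
excess (u , v , w) 3F = -ᶻ w -ᶻ u

-- Any ℓ consecutive classes have (ℓ N + their excess) / 2 vertices.  As
-- N ≤ 2 t, this is at most ℓ t + 1 when the excess is at most 3, by rounding.
Balanced : State → Set
Balanced x =
  (d 0F ≤ᶻ + 3 × d 1F ≤ᶻ + 3 × d 2F ≤ᶻ + 3 × d 3F ≤ᶻ + 3) ×
  (d 0F +ᶻ d 1F ≤ᶻ + 3 × d 1F +ᶻ d 2F ≤ᶻ + 3 × d 2F +ᶻ d 3F ≤ᶻ + 3) ×
  (d 0F +ᶻ d 1F +ᶻ d 2F ≤ᶻ + 3 × d 1F +ᶻ d 2F +ᶻ d 3F ≤ᶻ + 3)
  where
  d : Fin 4 → ℤ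
  d = excess x

-- Reduction to finitely many states

Interior : ℤ → Set
Interior z = ∣ z ∣ ≢ 4

interior? : ∀ z → Dec (Interior z)
interior? z = ¬? (∣ z ∣ ≟ 4)

-- A coordinate ±4 stands for all coordinates beyond it, where the linear form
-- of a rule must not be larger.
Slack : ℤ → ℤ → Set
Slack a z = (z ≡ + 4 → a ≤ᶻ 0ℤ) × (z ≡ -[1+ 3 ] → 0ℤ ≤ᶻ a)

-- A move this short, made from a coordinate ±4 or beyond, neither reaches 0 nor changes the sign,
-- so it stays on one affine piece of `wedge`.
Small : State → Set
Small (u , v , w) = ∣ u ∣ ≤ 3 × ∣ v ∣ ≤ 3 × ∣ w ∣ ≤ 3

Applies : Rule → State → Set
Applies ρ x@(u , v , w) =
  linear ρ x <ᶻ 0ℤ × Slack (onTilt ρ) u × Slack (onLow ρ) v × Slack (onMiddle ρ) w ×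
  All (λ δ → Small δ × potential (x ⊞ δ) < potential x) (moves ρ)

-- Only states with v − w even occur.
Covered : State → Set
Covered x@(u , v , w) =
  (Interior v × Interior w × ∣ v -ᶻ w ∣ % 2 ≡ 1) ⊎
  (Interior u × Interior v × Interior w × Balanced x) ⊎
  Any (λ ρ → Applies ρ x) rules

slack? : ∀ a z → Dec (Slack a z)
slack? a z = ((z ℤ.≟ + 4) →-dec (a ≤ᶻ? 0ℤ)) ×-dec ((z ℤ.≟ -[1+ 3 ]) →-dec (0ℤ ≤ᶻ? a))

balanced? : ∀ x → Dec (Balanced x)
balanced? x =
  (_ ≤ᶻ? _ ×-dec _ ≤ᶻ? _ ×-dec _ ≤ᶻ? _ ×-dec _ ≤ᶻ? _) ×-dec
  (_ ≤ᶻ? _ ×-dec _ ≤ᶻ? _ ×-dec _ ≤ᶻ? _) ×-dec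
  (_ ≤ᶻ? _ ×-dec _ ≤ᶻ? _)

applies? : ∀ ρ x → Dec (Applies ρ x)
applies? ρ x@(u , v , w) =
  (linear ρ x <ᶻ? 0ℤ) ×-dec slack? (onTilt ρ) u ×-dec slack? (onLow ρ) v ×-dec slack? (onMiddle ρ) w ×-dec
  all? (λ δ@(u′ , v′ , w′) →
    (∣ u′ ∣ ≤? 3 ×-dec ∣ v′ ∣ ≤? 3 ×-dec ∣ w′ ∣ ≤? 3) ×-dec
    (potential (x ⊞ δ) <? potential x)) (moves ρ)

covered? : ∀ x → Dec (Covered x)
covered? x@(u , v , w) =
  (interior? v ×-dec interior? w ×-dec (∣ v -ᶻ w ∣ % 2 ≟ 1)) ⊎-dec
  (interior? u ×-dec interior? v ×-dec interior? w ×-dec balanced? x) ⊎-dec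
  any? (λ ρ → applies? ρ x) rules

window : List ℤ
window = -[1+ 3 ] ∷ -[1+ 2 ] ∷ -[1+ 1 ] ∷ -[1+ 0 ] ∷ + 0 ∷ + 1 ∷ + 2 ∷ + 3 ∷ + 4 ∷ []

abstract
  -- The finite check, over 9³ = 729 clamped states.
  window-covered : All (λ u → All (λ v → All (λ w → Covered (u , v , w)) window) window) window
  window-covered = toWitness
    {a? = all? (λ u → all? (λ v → all? (λ w → covered? (u , v , w)) window) window) window} _

-- Relates a clamped coordinate to the true one, with the overshoot `k` beyond ±4.
data Clamp : ℤ → ℤ → Set where
  inside  : ∀ {z} → Clamp z z
  above   : ∀ k → Clamp (+ 4) (+ (4 + k))
  beneath : ∀ k → Clamp -[1+ 3 ] -[1+ 3 + k ]

clamp : ∀ z → ∃[ y ] y ∈ᴸ window × Clamp y z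
clamp (+ 0) = + 0 , there (there (there (there (here refl)))) , inside
clamp (+ 1) = + 1 , there (there (there (there (there (here refl))))) , inside
clamp (+ 2) = + 2 , there (there (there (there (there (there (here refl)))))) , inside
clamp (+ 3) = + 3 , there (there (there (there (there (there (there (here refl))))))) , inside
clamp (+ suc (suc (suc (suc k)))) =
  + 4 , there (there (there (there (there (there (there (there (here refl)))))))) , above k
clamp -[1+ 0 ] = -[1+ 0 ] , there (there (there (here refl))) , inside
clamp -[1+ 1 ] = -[1+ 1 ] , there (there (here refl)) , inside
clamp -[1+ 2 ] = -[1+ 2 ] , there (here refl) , inside
clamp -[1+ suc (suc (suc k)) ] = -[1+ 3 ] , here refl , beneath k

clamp-interior : ∀ {y z} → Clamp y z → Interior y → y ≡ z
clamp-interior inside      _   = refl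
clamp-interior (above k)   y≢4 = contradiction refl y≢4
clamp-interior (beneath k) y≢4 = contradiction refl y≢4

-- By `Slack`, moving outwards from ±4 never increases the contribution of this coordinate to the
-- linear form.
clamp-slack : ∀ {a y z} → Clamp y z → Slack a y → a *ᶻ z ≤ᶻ a *ᶻ y
clamp-slack inside _ = ℤ.≤-refl
clamp-slack {a = a} (above k) (a≤0 , _) =
  ℤ.*-monoˡ-≤-nonPos a {{nonPositive (a≤0 refl)}} (+≤+ (ℕ.m≤m+n 4 k))
clamp-slack {a = a} (beneath k) (_ , 0≤a) =
  ℤ.*-monoˡ-≤-nonNeg a {{nonNegative (0≤a refl)}} (-≤- (ℕ.m≤m+n 3 k))

module _ {z p q p′ q′ : ℕ} where
  private
    h : ℤ → ℕ
    h = wedge z p q p′ q′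

    slide : ∀ p q j k → p + q * (j + k) ≡ p + q * j + q * k
    slide = ℕ-Solver.solve-∀

  -- The surplus `d` is the same for all short moves `e`, including 0, so it cancels from potential
  -- differences.
  clamp-wedge : ∀ {y z} → Clamp y z →
    ∃[ d ] (∀ e → ∣ e ∣ ≤ 3 → h (z +ᶻ e) ≡ h (y +ᶻ e) + d × sgn (z +ᶻ e) ≡ sgn (y +ᶻ e))
  clamp-wedge inside = 0 , λ e _ → sym (ℕ.+-identityʳ _) , refl
  clamp-wedge (above k) = q * k , go
    where
    go : ∀ e → ∣ e ∣ ≤ 3 →
      h (+ (4 + k) +ᶻ e) ≡ h (+ 4 +ᶻ e) + q * k × sgn (+ (4 + k) +ᶻ e) ≡ sgn (+ 4 +ᶻ e)
    go (+ j) _ = trans (cong (λ t → p + q * (3 + t)) (ℕ.+-comm k j)) (slide p q (3 + j) k) , refl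
    go -[1+ 0 ] _ = slide p q 2 k , refl
    go -[1+ 1 ] _ = slide p q 1 k , refl
    go -[1+ 2 ] _ = slide p q 0 k , refl
    go -[1+ suc (suc (suc _)) ] (s≤s (s≤s (s≤s ())))
  clamp-wedge (beneath k) = q′ * k , go
    where
    go : ∀ e → ∣ e ∣ ≤ 3 →
      h (-[1+ 3 + k ] +ᶻ e) ≡ h (-[1+ 3 ] +ᶻ e) + q′ * k × sgn (-[1+ 3 + k ] +ᶻ e) ≡ sgn (-[1+ 3 ] +ᶻ e)
    go (+ 0) _ = slide p′ q′ 3 k , refl
    go (+ 1) _ = slide p′ q′ 2 k , refl
    go (+ 2) _ = slide p′ q′ 1 k , refl
    go (+ 3) _ = slide p′ q′ 0 k , refl
    go (+ suc (suc (suc (suc _)))) (s≤s (s≤s (s≤s ())))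
    go -[1+ j ] _ = trans (cong (λ t → p′ + q′ * (4 + t)) (ℕ.+-comm k j)) (slide p′ q′ (4 + j) k) , refl

-- A datatype, so that comparing states never unfolds the potential.
data Below (y x : State) : Set where
  below : potential y < potential x → Below y x

below⁻¹ : ∀ {y x} → Below y x → potential y < potential x
below⁻¹ (below lt) = lt

Improves : Rule → State → Set
Improves ρ x = linear ρ x <ᶻ 0ℤ × All (λ δ → Below (x ⊞ δ) x) (moves ρ)

follow-move : ∀ {T x y} d → y ≡ x ⊞ d → Any (d ≡_) T → All (λ δ → Below (x ⊞ δ) x) T → Below y x
follow-move d refl (here refl) (lt All.∷ _)  = lt
follow-move d y≡   (there d∈)  (_ All.∷ lts) = follow-move d y≡ d∈ lts

-- Around the true state the potential exceeds that around the clamped one by the constant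
-- `d₁ + d₂ + d₃`, as the signs in `twist` agree; hence the same moves descend. The linear form is
-- no larger than at the clamped state.
clamp-applies : ∀ {ρ y₁ y₂ y₃ u v w} → Clamp y₁ u → Clamp y₂ v → Clamp y₃ w →
  Applies ρ (y₁ , y₂ , y₃) → Improves ρ (u , v , w)
clamp-applies {ρ} {y₁} {y₂} {y₃} {u} {v} {w} cu cv cw (negative , su , sv , sw , down)
  with clamp-wedge {0} {1} {5} {1} {5} cu | clamp-wedge {0} {2} {6} {2} {6} cv | clamp-wedge {3} {5} {10} {0} {6} cw
... | d₁ , f≡ | d₂ , g≡ | d₃ , h≡ =
  ℤ.≤-<-trans
    (ℤ.+-mono-≤ (clamp-slack cu su)
      (ℤ.*-monoˡ-≤-nonNeg (+ 2) (ℤ.+-mono-≤ (clamp-slack cv sv) (clamp-slack cw sw)))) negative ,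
  All.map (λ {δ} → descend δ) down
  where
  x y : State
  x = u , v , w
  y = y₁ , y₂ , y₃

  regroup : ∀ f g h t d₁ d₂ d₃ → (f + d₁) + (g + d₂) + (h + d₃) + t ≡ f + g + h + t + (d₁ + d₂ + d₃)
  regroup = ℕ-Solver.solve-∀

  raised : ∀ δ → Small δ → potential (x ⊞ δ) ≡ potential (y ⊞ δ) + (d₁ + d₂ + d₃)
  raised (e₁ , e₂ , e₃) (s₁ , s₂ , s₃) = trans
    (cong₂ _+_ (cong₂ _+_ (cong₂ _+_ (proj₁ (f≡ e₁ s₁)) (proj₁ (g≡ e₂ s₂))) (proj₁ (h≡ e₃ s₃)))
               (cong₂ twist (proj₂ (f≡ e₁ s₁)) (proj₂ (g≡ e₂ s₂))))
    (regroup (height₁ (y₁ +ᶻ e₁)) (height₂ (y₂ +ᶻ e₂)) (height₃ (y₃ +ᶻ e₃)) _ d₁ d₂ d₃)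

  ⊞-0 : ∀ x → x ⊞ (0ℤ , 0ℤ , 0ℤ) ≡ x
  ⊞-0 (a , b , c) = cong₂ _,_ (ℤ.+-identityʳ a) (cong₂ _,_ (ℤ.+-identityʳ b) (ℤ.+-identityʳ c))

  raised-0 : potential x ≡ potential y + (d₁ + d₂ + d₃)
  raised-0 = subst₂ (λ x′ y′ → potential x′ ≡ potential y′ + (d₁ + d₂ + d₃)) (⊞-0 x) (⊞-0 y)
    (raised _ (z≤n , z≤n , z≤n))

  descend : ∀ δ → Small δ × potential (y ⊞ δ) < potential y → Below (x ⊞ δ) x
  descend δ (small , lt) = below (subst₂ _<_ (sym (raised δ small)) (sym raised-0) (ℕ.+-monoˡ-< _ lt))

-- The table entry of the clamped state decides. Its odd alternative has interior second and third
-- coordinates, which clamping leaves alone, and so contradicts the evenness of v - w.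
balanced-or-improves : ∀ u v w → (∃[ k ] v -ᶻ w ≡ + 2 *ᶻ k) →
  Balanced (u , v , w) ⊎ ∃[ ρ ] ρ ∈ᴸ rules × Improves ρ (u , v , w)
balanced-or-improves u v w (k , v-w≡2k) with clamp u | clamp v | clamp w
... | y₁ , ∈₁ , cu | y₂ , ∈₂ , cv | y₃ , ∈₃ , cw
  with All.lookup (All.lookup (All.lookup window-covered ∈₁) ∈₂) ∈₃
... | inj₁ (iv , iw , odd) rewrite clamp-interior cv iv | clamp-interior cw iw =
  contradiction (trans (sym odd) even) λ ()
  where
  open ≡-Reasoning
  even : ∣ v -ᶻ w ∣ % 2 ≡ 0
  even = begin
    ∣ v -ᶻ w ∣ % 2     ≡⟨ cong (λ z → ∣ z ∣ % 2) v-w≡2k ⟩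
    ∣ + 2 *ᶻ k ∣ % 2   ≡⟨ cong (_% 2) (trans (ℤ.abs-* (+ 2) k) (ℕ.*-comm 2 ∣ k ∣)) ⟩
    (∣ k ∣ * 2) % 2    ≡⟨ m*n%n≡0 ∣ k ∣ 2 ⟩
    0                  ∎
... | inj₂ (inj₁ (iu , iv , iw , balanced))
  rewrite clamp-interior cu iu | clamp-interior cv iv | clamp-interior cw iw = inj₁ balanced
... | inj₂ (inj₂ some) = let ρ , ρ∈ , applies = find some in
  inj₂ (ρ , ρ∈ , clamp-applies {ρ} cu cv cw applies)

-- Local search

sum-const : ∀ n c → sum {n} (λ _ → c) ≡ + n *ᶻ c
sum-const zero    c = refl
sum-const (suc n) c = trans (cong (c +ᶻ_) (sum-const n c)) (sym (ℤ.suc-* (+ n) c))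

sum-nonNeg : ∀ {n} {f : Fin n → ℤ} → (∀ i → 0ℤ ≤ᶻ f i) → 0ℤ ≤ᶻ sum f
sum-nonNeg {zero}  f≥0 = ℤ.≤-refl
sum-nonNeg {suc n}  f≥0 = ℤ.+-mono-≤ (f≥0 0F) (sum-nonNeg (f≥0 ∘ suc))

transfer-antisym : ∀ t r r′ → transfer t r r′ +ᶻ transfer t r′ r ≡ 0ℤ
transfer-antisym _           0F 0F = refl
transfer-antisym (p , q , r) 0F 1F = ℤ.+-inverseʳ p
transfer-antisym (p , q , r) 0F 2F = ℤ.+-inverseʳ q
transfer-antisym (p , q , r) 1F 0F = ℤ.+-inverseˡ p
transfer-antisym _           1F 1F = refl
transfer-antisym (p , q , r) 1F 2F = ℤ.+-inverseʳ r
transfer-antisym (p , q , r) 2F 0F = ℤ.+-inverseˡ q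
transfer-antisym (p , q , r) 2F 1F = ℤ.+-inverseˡ r
transfer-antisym _           2F 2F = refl

flow-antisym : ∀ ρ b r r′ → flow ρ b r r′ +ᶻ flow ρ b r′ r ≡ 0ℤ
flow-antisym ρ false = transfer-antisym (absent ρ)
flow-antisym ρ true  = transfer-antisym (present ρ)

-- Chosen to make `low-middle` exact: for a degree d at most 3, `low d` falls short of `middle d` +
-- 1 + d by the even number 2 `half d`.
half : ℕ → ℤ
half 0 = + 0
half 1 = + 1
half _ = + 2

low-middle : ∀ h → low (total h) +ᶻ + 2 *ᶻ half (total h) ≡
  middle (total h) +ᶻ (+ 1 +ᶻ sum (λ i → + bit (h i)))
low-middle h with h 0F | h 1F | h 2F
... | true  | true  | true  = refl
... | true  | true  | false = refl
... | true  | false | true  = refl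
... | true  | false | false = refl
... | false | true  | true  = refl
... | false | true  | false = refl
... | false | false | true  = refl
... | false | false | false = refl

module Descent (G : Graph) (cubic : Cubic G) where
  open Graph G
  open CubicGraph G cubic

  -- Half the number of vertices, written without division: by the handshake identity there are 3 N
  -- edges.
  N : ℤ
  N = + size -ᶻ + order

  handshake : + 3 *ᶻ + order ≡ + 2 *ᶻ + size
  handshake = begin
    + 3 *ᶻ + order                              ≡⟨ ℤ.*-comm (+ 3) (+ order) ⟩
    + order *ᶻ + 3                              ≡⟨ sum-const order (+ 3) ⟨
    sum {order} (λ v → + 3)                     ≡⟨ double-count (λ _ _ → + 1) ⟩
    sum {size} (λ e → + 2)                      ≡⟨ sum-const size (+ 2) ⟩
    + size *ᶻ + 2                               ≡⟨ ℤ.*-comm (+ size) (+ 2) ⟩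
    + 2 *ᶻ + size                               ∎
    where open ≡-Reasoning

  order≡2N : + order ≡ + 2 *ᶻ N
  order≡2N = begin
    + order                                   ≡⟨ split (+ order) ⟩
    + 3 *ᶻ + order -ᶻ + 2 *ᶻ + order          ≡⟨ cong (_-ᶻ + 2 *ᶻ + order) handshake ⟩
    + 2 *ᶻ + size -ᶻ + 2 *ᶻ + order           ≡⟨ factor (+ size) (+ order) ⟩
    + 2 *ᶻ N                                  ∎
    where
    open ≡-Reasoning
    split : ∀ n → n ≡ + 3 *ᶻ n -ᶻ + 2 *ᶻ n
    split = ℤ-Solver.solve-∀
    factor : ∀ m n → + 2 *ᶻ m -ᶻ + 2 *ᶻ n ≡ + 2 *ᶻ (m -ᶻ n)
    factor = ℤ-Solver.solve-∀

  state : (E G → Bool) → State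
  state H = stat tilt H , stat low H -ᶻ N , stat middle H -ᶻ N

  chargeAt : Rule → (E G → Bool) → V G → ℤ
  chargeAt ρ H v = charge ρ (H ∘ edge v) (λ i → res H (nbr v i) (edge v i))

  flowAt : Rule → (E G → Bool) → V G → ℤ
  flowAt ρ H v = sum (λ i → flow ρ (H (edge v i)) (rest (H ∘ edge v) i) (res H (nbr v i) (edge v i)))

  -- Regrouped by edges, the two ends of each edge contribute opposite amounts.
  total-flow : ∀ ρ H → sum (flowAt ρ H) ≡ 0ℤ
  total-flow ρ H = begin
    sum (flowAt ρ H)                              ≡⟨ sum-cong-≗ (λ v → sum-cong-≗ (resituate v)) ⟨
    sum (λ v → sum (λ i → F v (edge v i)))        ≡⟨ double-count F ⟩
    sum (λ e → F (tip e 0F) e +ᶻ F (tip e 1F) e)  ≡⟨ sum-zero cancel ⟩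
    0ℤ                                            ∎
    where
    open ≡-Reasoning
    F : V G → E G → ℤ
    F v e = flow ρ (H e) (res H v e) (res H (other v e) e)
    resituate : ∀ v i → F v (edge v i) ≡
      flow ρ (H (edge v i)) (rest (H ∘ edge v) i) (res H (nbr v i) (edge v i))
    resituate v i = cong
      (λ j → flow ρ (H (edge v i)) (rest (H ∘ edge v) j) (res H (nbr v i) (edge v i)))
      (position-edge v i)
    cancel : ∀ e → F (tip e 0F) e +ᶻ F (tip e 1F) e ≡ 0ℤ
    cancel e rewrite other-0 e | other-1 e = flow-antisym ρ (H e) _ _

  total-weight : ∀ ρ H → sum (weightOf ρ ∘ deg H) ≡ linear ρ (state H)
  total-weight ρ H = begin
    sum (weightOf ρ ∘ deg H)
      ≡⟨ ∑-distrib-+ tilts (λ v → lows v +ᶻ middles v) ⟩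
    sum tilts +ᶻ sum (λ v → lows v +ᶻ middles v)
      ≡⟨ cong (sum tilts +ᶻ_) (∑-distrib-+ lows middles) ⟩
    sum tilts +ᶻ (sum lows +ᶻ sum middles)
      ≡⟨ cong₂ _+ᶻ_ (sym (*-distribˡ-sum (onTilt ρ) (tilt ∘ deg H)))
           (cong₂ _+ᶻ_ (centred (onLow ρ) low) (centred (onMiddle ρ) middle)) ⟩
    onTilt ρ *ᶻ stat tilt H +ᶻ (onLow ρ *ᶻ (+ 2 *ᶻ v₀) +ᶻ onMiddle ρ *ᶻ (+ 2 *ᶻ w₀))
      ≡⟨ cong (onTilt ρ *ᶻ stat tilt H +ᶻ_) (pull (onLow ρ) (onMiddle ρ) v₀ w₀) ⟩
    linear ρ (state H) ∎
    where
    open ≡-Reasoning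
    v₀ w₀ : ℤ
    v₀ = stat low H -ᶻ N
    w₀ = stat middle H -ᶻ N
    term : ℤ → (ℕ → ℤ) → V G → ℤ
    term k X v = k *ᶻ (+ 2 *ᶻ X (deg H v) -ᶻ + 1)
    tilts lows middles : V G → ℤ
    tilts v = onTilt ρ *ᶻ tilt (deg H v)
    lows = term (onLow ρ) low
    middles = term (onMiddle ρ) middle
    pull : ∀ b c v w → b *ᶻ (+ 2 *ᶻ v) +ᶻ c *ᶻ (+ 2 *ᶻ w) ≡ + 2 *ᶻ (b *ᶻ v +ᶻ c *ᶻ w)
    pull = ℤ-Solver.solve-∀
    recentre : ∀ s n → + 2 *ᶻ s +ᶻ (+ 2 *ᶻ n) *ᶻ -1ℤ ≡ + 2 *ᶻ (s -ᶻ n)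
    recentre = ℤ-Solver.solve-∀
    centred : ∀ k X → sum (term k X) ≡ k *ᶻ (+ 2 *ᶻ (stat X H -ᶻ N))
    centred k X = begin
      sum (term k X)
        ≡⟨ *-distribˡ-sum k (λ v → + 2 *ᶻ X (deg H v) -ᶻ + 1) ⟨
      k *ᶻ sum (λ v → + 2 *ᶻ X (deg H v) -ᶻ + 1)
        ≡⟨ cong (k *ᶻ_) (∑-distrib-+ (λ v → + 2 *ᶻ X (deg H v)) (λ _ → -1ℤ)) ⟩
      k *ᶻ (sum (λ v → + 2 *ᶻ X (deg H v)) +ᶻ sum {order} (λ _ → -1ℤ))
        ≡⟨ cong (k *ᶻ_) (cong₂ _+ᶻ_ (sym (*-distribˡ-sum (+ 2) (X ∘ deg H)))
             (trans (sum-const order -1ℤ) (cong (_*ᶻ -1ℤ) order≡2N))) ⟩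
      k *ᶻ (+ 2 *ᶻ stat X H +ᶻ (+ 2 *ᶻ N) *ᶻ -1ℤ)
        ≡⟨ cong (k *ᶻ_) (recentre (stat X H) N) ⟩
      k *ᶻ (+ 2 *ᶻ (stat X H -ᶻ N)) ∎

  total-charge : ∀ ρ H → sum (chargeAt ρ H) ≡ linear ρ (state H)
  total-charge ρ H = trans (∑-distrib-+ (weightOf ρ ∘ deg H) (flowAt ρ H))
    (trans (cong₂ _+ᶻ_ (total-weight ρ H) (total-flow ρ H)) (ℤ.+-identityʳ _))

  negative-vertex : ∀ ρ H → linear ρ (state H) <ᶻ 0ℤ → ∃[ v ] chargeAt ρ H v <ᶻ 0ℤ
  negative-vertex ρ H neg with Fin.any? (λ v → chargeAt ρ H v <ᶻ? 0ℤ)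
  ... | yes found = found
  ... | no  none  = contradiction
    (ℤ.≤-<-trans (subst (0ℤ ≤ᶻ_) (total-charge ρ H) (sum-nonNeg λ v → ℤ.≮⇒≥ (none ∘ (v ,_)))) neg)
    (ℤ.<-irrefl refl)

  state-flip : ∀ c s H → state (flip c s H) ≡
    state H ⊞ displacement (H ∘ edge c) (λ i → res H (nbr c i) (edge c i)) s
  state-flip c s H = cong₂ _,_ (stat-flip c s H tilt) (cong₂ _,_ (shifted low) (shifted middle))
    where
    swap : ∀ a b n → a +ᶻ b -ᶻ n ≡ a -ᶻ n +ᶻ b
    swap = ℤ-Solver.solve-∀
    shifted : ∀ X → stat X (flip c s H) -ᶻ N ≡
      stat X H -ᶻ N +ᶻ shift X (H ∘ edge c) (λ i → res H (nbr c i) (edge c i)) s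
    shifted X = trans (cong (_-ᶻ N) (stat-flip c s H X)) (swap (stat X H) _ N)

  -- A negative total forces a vertex of negative charge, and there validity of the rule supplies a
  -- flip realising a descending move.
  improve : ∀ ρ → ρ ∈ᴸ rules → ∀ H → Improves ρ (state H) → ∃[ H′ ] Below (state H′) (state H)
  improve ρ ρ∈ H (neg , down) = at (negative-vertex ρ H neg)
    where
    at : ∃[ v ] chargeAt ρ H v <ᶻ 0ℤ → ∃[ H′ ] Below (state H′) (state H)
    at (v , charge<0) =
      [ (λ charge≥0 → contradiction (ℤ.≤-<-trans charge≥0 charge<0) (ℤ.<-irrefl refl))
      , (λ (s₀ , s₁ , s₂ , some) → let s = tri s₀ s₁ s₂ in
           flip v s H , follow-move _ (state-flip v s H) some down) ]′
      (discharged {ρ} (All.lookup rules-valid ρ∈) (H ∘ edge v) (λ i → res H (nbr v i) (edge v i)))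

  -- Sum `low-middle` over the vertices: the order 2 N and the degree sum of `H` are both even.
  state-parity : ∀ H → ∃[ k ] (stat low H -ᶻ N) -ᶻ (stat middle H -ᶻ N) ≡ + 2 *ᶻ k
  state-parity H = N +ᶻ e -ᶻ y , (begin
    (stat low H -ᶻ N) -ᶻ (stat middle H -ᶻ N)
      ≡⟨ isolate (stat low H) (stat middle H) N y ⟩
    stat low H +ᶻ + 2 *ᶻ y -ᶻ stat middle H -ᶻ + 2 *ᶻ y
      ≡⟨ cong (λ t → t -ᶻ stat middle H -ᶻ + 2 *ᶻ y) summed ⟩
    stat middle H +ᶻ (+ 2 *ᶻ N +ᶻ + 2 *ᶻ e) -ᶻ stat middle H -ᶻ + 2 *ᶻ y
      ≡⟨ collect (stat middle H) N e y ⟩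
    + 2 *ᶻ (N +ᶻ e -ᶻ y) ∎)
    where
    open ≡-Reasoning
    e = sum (λ x → + bit (H x))
    bits : V G → ℤ
    bits v = sum (λ i → + bit (H (edge v i)))
    y = stat half H
    isolate : ∀ v w n y → (v -ᶻ n) -ᶻ (w -ᶻ n) ≡ v +ᶻ + 2 *ᶻ y -ᶻ w -ᶻ + 2 *ᶻ y
    isolate = ℤ-Solver.solve-∀
    collect : ∀ w n e y → w +ᶻ (+ 2 *ᶻ n +ᶻ + 2 *ᶻ e) -ᶻ w -ᶻ + 2 *ᶻ y ≡ + 2 *ᶻ (n +ᶻ e -ᶻ y)
    collect = ℤ-Solver.solve-∀
    double : ∀ b → b +ᶻ b ≡ + 2 *ᶻ b
    double = ℤ-Solver.solve-∀
    degree-sum : sum bits ≡ + 2 *ᶻ e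
    degree-sum = trans (double-count (λ _ x → + bit (H x)))
      (trans (sum-cong-≗ (λ x → double (+ bit (H x)))) (sym (*-distribˡ-sum (+ 2) (λ x → + bit (H x)))))
    summed : stat low H +ᶻ + 2 *ᶻ y ≡ stat middle H +ᶻ (+ 2 *ᶻ N +ᶻ + 2 *ᶻ e)
    summed = begin
      stat low H +ᶻ + 2 *ᶻ y
        ≡⟨ cong (stat low H +ᶻ_) (*-distribˡ-sum (+ 2) (half ∘ deg H)) ⟩
      stat low H +ᶻ sum (λ v → + 2 *ᶻ half (deg H v))
        ≡⟨ ∑-distrib-+ (low ∘ deg H) (λ v → + 2 *ᶻ half (deg H v)) ⟨
      sum (λ v → low (deg H v) +ᶻ + 2 *ᶻ half (deg H v))
        ≡⟨ sum-cong-≗ (λ v → low-middle (H ∘ edge v)) ⟩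
      sum (λ v → middle (deg H v) +ᶻ (+ 1 +ᶻ bits v))
        ≡⟨ ∑-distrib-+ (middle ∘ deg H) (λ v → + 1 +ᶻ bits v) ⟩
      stat middle H +ᶻ sum (λ v → + 1 +ᶻ bits v)
        ≡⟨ cong (stat middle H +ᶻ_) (∑-distrib-+ {order} (λ _ → + 1) bits) ⟩
      stat middle H +ᶻ (sum {order} (λ _ → + 1) +ᶻ sum bits)
        ≡⟨ cong (stat middle H +ᶻ_) (cong₂ _+ᶻ_
             (trans (sum-const order (+ 1)) (trans (ℤ.*-identityʳ _) order≡2N)) degree-sum) ⟩
      stat middle H +ᶻ (+ 2 *ᶻ N +ᶻ + 2 *ᶻ e) ∎

  balanced-subgraph : ∃[ H ] Balanced (state H)
  -- Start from the empty edge set; each improvement lowers a natural number.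
  balanced-subgraph = descend (λ _ → false) (<-wellFounded _)
    where
    descend : ∀ H → Acc _<_ (potential (state H)) → ∃[ H ] Balanced (state H)
    descend H (acc rs) =
      [ (λ balanced → H , balanced)
      , (λ (ρ , ρ∈ , imp) → let H′ , H′<H = improve ρ ρ∈ H imp in descend H′ (rs (below⁻¹ H′<H))) ]′
      (balanced-or-improves (stat tilt H) (stat low H -ᶻ N) (stat middle H -ᶻ N) (state-parity H))

-- Placing the weights

count : ∀ {n} → (Fin n → Bool) → ℕ
count {zero}  p = 0
count {suc n} p = bit (p zero) + count (p ∘ suc)

rank : ∀ {n} → (Fin n → Bool) → Fin n → ℕ
rank p zero    = 0
rank p (suc i) = bit (p zero) + rank (p ∘ suc) i

rank<count : ∀ {n} (p : Fin n → Bool) i → p i ≡ true → rank p i < count p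
rank<count p zero    pi rewrite pi = s≤s z≤n
rank<count p (suc i) pi = ℕ.+-monoʳ-< (bit (p zero)) (rank<count (p ∘ suc) i pi)

rank-injective : ∀ {n} (p : Fin n → Bool) i j → p i ≡ true → p j ≡ true → rank p i ≡ rank p j → i ≡ j
rank-injective p zero    zero    _  _  _  = refl
rank-injective p zero    (suc j) pi _  eq rewrite pi with () ← eq
rank-injective p (suc i) zero    _  pj eq rewrite pj with () ← eq
rank-injective p (suc i) (suc j) pi pj eq =
  cong suc (rank-injective (p ∘ suc) i j pi pj (ℕ.+-cancelˡ-≡ (bit (p zero)) _ _ eq))

-- Vertices of class k may take the positions k t, …, (k + 1) t; consecutive
-- intervals share one position, and they are filled greedily from the left.
module Placement {n : ℕ} (class : Fin n → ℕ) (t : ℕ) where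

  members : ℕ → Fin n → Bool
  members k v = does (class v ≟ k)

  population : ℕ → ℕ
  population = count ∘ members

  offset : ℕ → ℕ
  offset zero    = 0
  offset (suc k) = suc k * t ⊔ (offset k + population k)

  place : Fin n → ℕ
  place v = offset (class v) + rank (members (class v)) v

  own-class : ∀ v → members (class v) v ≡ true
  own-class v = dec-true (class v ≟ class v) refl

  offset-lower : ∀ k → k * t ≤ offset k
  offset-lower zero    = z≤n
  offset-lower (suc k) = ℕ.m≤m⊔n (suc k * t) _

  offset-gap : ∀ {j k} → j < k → offset j + population j ≤ offset k
  offset-gap {j} {suc k} (s≤s j≤k) with ℕ.m≤n⇒m<n∨m≡n j≤k
  ... | inj₁ j<k  = ℕ.≤-trans (offset-gap j<k) (ℕ.≤-trans (ℕ.m≤m+n _ _) (ℕ.m≤n⊔m (suc k * t) _))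
  ... | inj₂ refl = ℕ.m≤n⊔m (suc k * t) _

  place-lower : ∀ v → class v * t ≤ place v
  place-lower v = ℕ.≤-trans (offset-lower (class v)) (ℕ.m≤m+n _ _)

  place-end : ∀ v → place v < offset (class v) + population (class v)
  place-end v = ℕ.+-monoʳ-< (offset (class v)) (rank<count (members (class v)) v (own-class v))

  place-mono : ∀ {v w} → class v < class w → place v < place w
  place-mono {v} {w} lt = ℕ.<-≤-trans (place-end v) (ℕ.≤-trans (offset-gap lt) (ℕ.m≤m+n _ _))

  place-injective : Injective _≡_ _≡_ place
  place-injective {v} {w} eq with ℕ.<-cmp (class v) (class w)
  ... | tri< lt _ _ = contradiction eq (ℕ.<⇒≢ (place-mono lt))
  ... | tri> _ _ gt = contradiction (sym eq) (ℕ.<⇒≢ (place-mono gt))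
  ... | tri≈ _ same _ = rank-injective (members (class v)) v w (own-class v)
    (subst (λ k → members k w ≡ true) (sym same) (own-class w))
    (ℕ.+-cancelˡ-≡ (offset (class v)) _ _
      (subst (λ k → place v ≡ offset k + rank (members k) w) (sym same) eq))

  -- Splits by the term of the maximum that defines the offset: the class starts at its own left
  -- end, or right after its predecessor. In the uses, `x` collects the populations from class
  -- `suc k` on.
  offset-step : ∀ k {x B} → suc k * t + x ≤ B → offset k + (population k + x) ≤ B → offset (suc k) + x ≤ B
  offset-step k {x} {B} low high =
    subst (_≤ B) (sym (ℕ.+-distribʳ-⊔ x (suc k * t) (offset k + population k)))
      (ℕ.⊔-lub low (subst (_≤ B) (sym (ℕ.+-assoc (offset k) (population k) x)) high))

  -- A Hall condition: ℓ consecutive intervals together contain ℓ t + 1 positions.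
  Fits : Set
  Fits =
    (#0 ≤ 1 * t + 1 × #1 ≤ 1 * t + 1 × #2 ≤ 1 * t + 1 × #3 ≤ 1 * t + 1) ×
    (#0 + #1 ≤ 2 * t + 1 × #1 + #2 ≤ 2 * t + 1 × #2 + #3 ≤ 2 * t + 1) ×
    (#0 + (#1 + #2) ≤ 3 * t + 1 × #1 + (#2 + #3) ≤ 3 * t + 1) ×
    #0 + (#1 + (#2 + #3)) ≤ 4 * t + 1
    where
    #0 #1 #2 #3 : ℕ
    #0 = population 0
    #1 = population 1
    #2 = population 2
    #3 = population 3

  stack : ∀ a {b x} → x ≤ b * t + 1 → a * t + x ≤ (a + b) * t + 1
  stack a {b} {x} x≤ = begin
    a * t + x             ≤⟨ ℕ.+-monoʳ-≤ (a * t) x≤ ⟩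
    a * t + (b * t + 1)   ≡⟨ ℕ.+-assoc (a * t) (b * t) 1 ⟨
    a * t + b * t + 1     ≡⟨ cong (_+ 1) (ℕ.*-distribʳ-+ t a b) ⟨
    (a + b) * t + 1       ∎
    where open ℕ.≤-Reasoning

  -- Trace the greedy filling back to the last class that starts at its own left end; the classes
  -- from there to `k` form a consecutive run, bounded by one inequality of `Fits`.
  offset-upper : Fits → ∀ k → k ≤ 3 → offset k + population k ≤ suc k * t + 1
  offset-upper ((s₀ , _) , _) 0 _ = s₀
  offset-upper ((_ , s₁ , _) , (s₀₁ , _) , _) 1 _ = offset-step 0 (stack 1 {1} s₁) s₀₁
  offset-upper ((_ , _ , s₂ , _) , (_ , s₁₂ , _) , (s₀₁₂ , _) , _) 2 _ =
    offset-step 1 (stack 2 {1} s₂) (offset-step 0 (stack 1 {2} s₁₂) s₀₁₂)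
  offset-upper ((_ , _ , _ , s₃) , (_ , _ , s₂₃) , (_ , s₁₂₃) , s₀₁₂₃) 3 _ =
    offset-step 2 (stack 3 {1} s₃) (offset-step 1 (stack 2 {2} s₂₃) (offset-step 0 (stack 1 {3} s₁₂₃) s₀₁₂₃))
  offset-upper _ (suc (suc (suc (suc _)))) (s≤s (s≤s (s≤s ())))

  place-upper : Fits → ∀ v → class v ≤ 3 → place v ≤ class v * t + t
  place-upper fits v class≤3 = s≤s⁻¹ (begin-strict
    place v                                  <⟨ place-end v ⟩
    offset (class v) + population (class v)  ≤⟨ offset-upper fits (class v) class≤3 ⟩
    suc (class v) * t + 1                    ≡⟨ ℕ.+-comm _ 1 ⟩
    suc (t + class v * t)                    ≡⟨ cong suc (ℕ.+-comm t _) ⟩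
    suc (class v * t + t)                    ∎)
    where open ℕ.≤-Reasoning

-- From the state of an edge set to its class sizes

count-sum : ∀ {n} (p : Fin n → Bool) → sum (λ v → + bit (p v)) ≡ + count p
count-sum {zero}  p = refl
count-sum {suc n} p = cong (+ bit (p zero) +ᶻ_) (count-sum (p ∘ suc))

total≤3 : ∀ h → total h ≤ 3
total≤3 h = ℕ.+-mono-≤ (ℕ.+-mono-≤ (bit≤1 (h 0F)) (bit≤1 (h 1F))) (bit≤1 (h 2F))
  where
  bit≤1 : ∀ b → bit b ≤ 1
  bit≤1 true  = ℕ.≤-refl
  bit≤1 false = z≤n

-- The rounding step: by parity, a surplus of 3 in the doubled inequality costs only 1 after
-- halving.
double-cancel-≤ : ∀ {a b} → + 2 *ᶻ + a ≤ᶻ + 2 *ᶻ + b +ᶻ + 3 → a ≤ b + 1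
double-cancel-≤ {a} {b} 2a≤2b+3 = ℕ.≮⇒≥ λ b+1<a → ℕ.<⇒≱ (begin-strict
    2 * b + 3        <⟨ ℕ.≤-reflexive (expand b) ⟩
    2 * suc (b + 1)  ≤⟨ ℕ.*-monoʳ-≤ 2 b+1<a ⟩
    2 * a            ∎) 2a≤2b+3ᴺ
  where
  open ℕ.≤-Reasoning
  expand : ∀ b → suc (2 * b + 3) ≡ 2 * suc (b + 1)
  expand = ℕ-Solver.solve-∀
  2a≤2b+3ᴺ : 2 * a ≤ 2 * b + 3
  2a≤2b+3ᴺ = ℤ.drop‿+≤+ (subst₂ _≤ᶻ_ (sym (ℤ.pos-* 2 a)) (cong (_+ᶻ + 3) (sym (ℤ.pos-* 2 b))) 2a≤2b+3)

-- Coefficients of twice the indicator of degree k in terms of the constant 1, `tilt`, `low` and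
-- `middle`.
indicator : Fin 4 → ℤ × ℤ × ℤ × ℤ
indicator 0F = + 1 , + 1 , + 0       , -1ℤ
indicator 1F = -1ℤ , -1ℤ , + 2       , + 1
indicator 2F = + 1 , + 1 , -[1+ 1 ]  , + 1
indicator 3F = + 1 , -1ℤ , + 0       , -1ℤ

expansion : Fin 4 → ℕ → ℤ
expansion k d =
  let e , a , b , c = indicator k in e +ᶻ (a *ᶻ tilt d +ᶻ (b *ᶻ low d +ᶻ c *ᶻ middle d))

indicator-spec : ∀ k {d} → d ≤ 3 → + 2 *ᶻ + bit (does (d ≟ toℕ k)) ≡ expansion k d
indicator-spec 0F z≤n = refl
indicator-spec 1F z≤n = refl
indicator-spec 2F z≤n = refl
indicator-spec 3F z≤n = refl
indicator-spec 0F (s≤s z≤n) = refl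
indicator-spec 1F (s≤s z≤n) = refl
indicator-spec 2F (s≤s z≤n) = refl
indicator-spec 3F (s≤s z≤n) = refl
indicator-spec 0F (s≤s (s≤s z≤n)) = refl
indicator-spec 1F (s≤s (s≤s z≤n)) = refl
indicator-spec 2F (s≤s (s≤s z≤n)) = refl
indicator-spec 3F (s≤s (s≤s z≤n)) = refl
indicator-spec 0F (s≤s (s≤s (s≤s z≤n))) = refl
indicator-spec 1F (s≤s (s≤s (s≤s z≤n))) = refl
indicator-spec 2F (s≤s (s≤s (s≤s z≤n))) = refl
indicator-spec 3F (s≤s (s≤s (s≤s z≤n))) = refl

excess-spec : ∀ k N u v w →
  let e , a , b , c = indicator k in
  (+ 2 *ᶻ N) *ᶻ e +ᶻ (a *ᶻ u +ᶻ (b *ᶻ v +ᶻ c *ᶻ w)) ≡ + 1 *ᶻ N +ᶻ excess (u , v -ᶻ N , w -ᶻ N) k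
excess-spec 0F = expand
  where
  expand : ∀ N u v w → (+ 2 *ᶻ N) *ᶻ + 1 +ᶻ (+ 1 *ᶻ u +ᶻ (+ 0 *ᶻ v +ᶻ -1ℤ *ᶻ w)) ≡
    + 1 *ᶻ N +ᶻ (u -ᶻ (w -ᶻ N))
  expand = ℤ-Solver.solve-∀
excess-spec 1F = expand
  where
  expand : ∀ N u v w → (+ 2 *ᶻ N) *ᶻ -1ℤ +ᶻ (-1ℤ *ᶻ u +ᶻ (+ 2 *ᶻ v +ᶻ + 1 *ᶻ w)) ≡
    + 1 *ᶻ N +ᶻ (+ 2 *ᶻ (v -ᶻ N) +ᶻ (w -ᶻ N) -ᶻ u)
  expand = ℤ-Solver.solve-∀
excess-spec 2F = expand
  where
  expand : ∀ N u v w → (+ 2 *ᶻ N) *ᶻ + 1 +ᶻ (+ 1 *ᶻ u +ᶻ (-[1+ 1 ] *ᶻ v +ᶻ + 1 *ᶻ w)) ≡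
    + 1 *ᶻ N +ᶻ ((w -ᶻ N) -ᶻ + 2 *ᶻ (v -ᶻ N) +ᶻ u)
  expand = ℤ-Solver.solve-∀
excess-spec 3F = expand
  where
  expand : ∀ N u v w → (+ 2 *ᶻ N) *ᶻ + 1 +ᶻ (-1ℤ *ᶻ u +ᶻ (+ 0 *ᶻ v +ᶻ -1ℤ *ᶻ w)) ≡
    + 1 *ᶻ N +ᶻ (-ᶻ (w -ᶻ N) -ᶻ u)
  expand = ℤ-Solver.solve-∀

-- Uses the `lookup` and `cast` of `enumerate`, so that the three summands belong to `edge v 0F`,
-- `edge v 1F` and `edge v 2F` by definition.
sum-triple : ∀ {A : Set} (g : A → ℕ) (xs : List A) .(len : 3 ≡ length xs) →
  List.sum (map g xs) ≡ g (lookup xs (cast len 0F)) + (g (lookup xs (cast len 1F)) + g (lookup xs (cast len 2F)))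
sum-triple g (x ∷ y ∷ z ∷ []) _ = cong (λ t → g x + (g y + t)) (ℕ.+-identityʳ (g z))

-- The labeling and the lower bound

module Strength (G : Graph) (cubic : Cubic G) where
  open Graph G
  open CubicGraph G cubic
  open Descent G cubic

  -- This is s - 1, as ⌈(n + 3) / 4⌉ = ⌊(n + 6) / 4⌋.
  t : ℕ
  t = (order + 2) / 4

  s≡1+t : ⌈ (order + 3) / 4 ⌉ ≡ suc t
  s≡1+t = begin
    (order + 3 + 3) / 4       ≡⟨ cong (_/ 4) (shuffle order) ⟩
    (order + 2 + 4) / 4       ≡⟨ +-distrib-/-∣ʳ (order + 2) ∣-refl ⟩
    t + 1                     ≡⟨ ℕ.+-comm t 1 ⟩
    suc t                     ∎
    where
    open ≡-Reasoning
    shuffle : ∀ n → n + 3 + 3 ≡ n + 2 + 4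
    shuffle = ℕ-Solver.solve-∀

  order≤4t+1 : order ≤ 4 * t + 1
  order≤4t+1 = ℕ.+-cancelʳ-≤ 2 _ _ (begin
    order + 2                          ≡⟨ m≡m%n+[m/n]*n (order + 2) 4 ⟩
    (order + 2) % 4 + t * 4            ≤⟨ ℕ.+-monoˡ-≤ (t * 4) (s≤s⁻¹ (m%n<n (order + 2) 4)) ⟩
    3 + t * 4                          ≡⟨ shuffle t ⟩
    4 * t + 1 + 2                      ∎)
    where
    open ℕ.≤-Reasoning
    shuffle : ∀ t → 3 + t * 4 ≡ 4 * t + 1 + 2
    shuffle = ℕ-Solver.solve-∀

  -- Otherwise the order 2 N would be at least 4 t + 2, above the bound 4 t + 1.
  N≤2t : N ≤ᶻ + 2 *ᶻ + t
  N≤2t = ℤ.≮⇒≥ λ 2t<N → ℤ.<⇒≱ (begin-strict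
    + (4 * t + 1)                   <⟨ +<+ (ℕ.≤-reflexive (shuffle t)) ⟩
    + (2 * (1 + 2 * t))             ≡⟨ trans (ℤ.pos-* 2 (1 + 2 * t)) (cong (λ x → + 2 *ᶻ (+ 1 +ᶻ x)) (ℤ.pos-* 2 t)) ⟩
    + 2 *ᶻ (+ 1 +ᶻ + 2 *ᶻ + t)      ≤⟨ ℤ.*-monoˡ-≤-nonNeg (+ 2) (ℤ.i<j⇒suc[i]≤j 2t<N) ⟩
    + 2 *ᶻ N                        ≡⟨ order≡2N ⟨
    + order                         ∎) (+≤+ order≤4t+1)
    where
    open ℤ.≤-Reasoning
    shuffle : ∀ t → suc (4 * t + 1) ≡ 2 * (1 + 2 * t)
    shuffle = ℕ-Solver.solve-∀

  module Balance (H : E G → Bool) (balanced : Balanced (state H)) where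
    open Placement (deg H) t

    record Load (classes m : ℕ) (x : ℤ) : Set where
      constructor load
      field twice : + 2 *ᶻ + m ≡ + classes *ᶻ N +ᶻ x

    class-load : ∀ k → Load 1 (population (toℕ k)) (excess (state H) k)
    class-load k = let e , a , b , c = indicator k in load (begin
      + 2 *ᶻ + population (toℕ k)
        ≡⟨ cong (+ 2 *ᶻ_) (count-sum (members (toℕ k))) ⟨
      + 2 *ᶻ sum (λ v → + bit (members (toℕ k) v))
        ≡⟨ *-distribˡ-sum (+ 2) (λ v → + bit (members (toℕ k) v)) ⟩
      sum (λ v → + 2 *ᶻ + bit (members (toℕ k) v))
        ≡⟨ sum-cong-≗ (λ v → indicator-spec k (total≤3 (H ∘ edge v))) ⟩
      sum (expansion k ∘ deg H)
        ≡⟨ sum-+ (λ _ → e) (λ v → a *ᶻ tilt (deg H v) +ᶻ (b *ᶻ low (deg H v) +ᶻ c *ᶻ middle (deg H v)))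
             (sum-const order e)
             (sum-+ (λ v → a *ᶻ tilt (deg H v)) (λ v → b *ᶻ low (deg H v) +ᶻ c *ᶻ middle (deg H v)) (scaled a tilt)
               (sum-+ (λ v → b *ᶻ low (deg H v)) (λ v → c *ᶻ middle (deg H v)) (scaled b low) (scaled c middle))) ⟩
      + order *ᶻ e +ᶻ (a *ᶻ stat tilt H +ᶻ (b *ᶻ stat low H +ᶻ c *ᶻ stat middle H))
        ≡⟨ cong (λ n → n *ᶻ e +ᶻ (a *ᶻ stat tilt H +ᶻ (b *ᶻ stat low H +ᶻ c *ᶻ stat middle H))) order≡2N ⟩
      (+ 2 *ᶻ N) *ᶻ e +ᶻ (a *ᶻ stat tilt H +ᶻ (b *ᶻ stat low H +ᶻ c *ᶻ stat middle H))
        ≡⟨ excess-spec k N (stat tilt H) (stat low H) (stat middle H) ⟩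
      + 1 *ᶻ N +ᶻ excess (state H) k ∎)
      where
      open ≡-Reasoning
      sum-+ : ∀ (f g : V G → ℤ) {x y} → sum f ≡ x → sum g ≡ y → sum (λ v → f v +ᶻ g v) ≡ x +ᶻ y
      sum-+ f g f≡ g≡ = trans (∑-distrib-+ f g) (cong₂ _+ᶻ_ f≡ g≡)
      scaled : ∀ k X → sum (λ v → k *ᶻ X (deg H v)) ≡ k *ᶻ stat X H
      scaled k X = sym (*-distribˡ-sum k (X ∘ deg H))

    infixr 5 _⊕_
    _⊕_ : ∀ {m n i j x y} → Load i m x → Load j n y → Load (i + j) (m + n) (x +ᶻ y)
    _⊕_ {m} {n} {i} {j} {x} {y} (load p) (load q) = load (begin
      + 2 *ᶻ + (m + n)                           ≡⟨ cong (+ 2 *ᶻ_) (ℤ.pos-+ m n) ⟩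
      + 2 *ᶻ (+ m +ᶻ + n)                        ≡⟨ ℤ.*-distribˡ-+ (+ 2) (+ m) (+ n) ⟩
      + 2 *ᶻ + m +ᶻ + 2 *ᶻ + n                   ≡⟨ cong₂ _+ᶻ_ p q ⟩
      (+ i *ᶻ N +ᶻ x) +ᶻ (+ j *ᶻ N +ᶻ y)         ≡⟨ regroup (+ i) (+ j) N x y ⟩
      (+ i +ᶻ + j) *ᶻ N +ᶻ (x +ᶻ y)              ≡⟨ cong (λ l → l *ᶻ N +ᶻ (x +ᶻ y)) (ℤ.pos-+ i j) ⟨
      + (i + j) *ᶻ N +ᶻ (x +ᶻ y)                 ∎)
      where
      open ≡-Reasoning
      regroup : ∀ i j n x y → (i *ᶻ n +ᶻ x) +ᶻ (j *ᶻ n +ᶻ y) ≡ (i +ᶻ j) *ᶻ n +ᶻ (x +ᶻ y)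
      regroup = ℤ-Solver.solve-∀

    capacity : ∀ {l m x} → Load l m x → x ≤ᶻ + 3 → m ≤ l * t + 1
    capacity {l} {m} {x} (load 2m≡) x≤3 = double-cancel-≤ (begin
      + 2 *ᶻ + m                       ≡⟨ 2m≡ ⟩
      + l *ᶻ N +ᶻ x                    ≤⟨ ℤ.+-mono-≤ (ℤ.*-monoˡ-≤-nonNeg (+ l) N≤2t) x≤3 ⟩
      + l *ᶻ (+ 2 *ᶻ + t) +ᶻ + 3       ≡⟨ cong (_+ᶻ + 3) (swap (+ l) (+ t)) ⟩
      + 2 *ᶻ (+ l *ᶻ + t) +ᶻ + 3       ≡⟨ cong (λ x → + 2 *ᶻ x +ᶻ + 3) (ℤ.pos-* l t) ⟨
      + 2 *ᶻ + (l * t) +ᶻ + 3          ∎)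
      where
      open ℤ.≤-Reasoning
      swap : ∀ l t → l *ᶻ (+ 2 *ᶻ t) ≡ + 2 *ᶻ (l *ᶻ t)
      swap = ℤ-Solver.solve-∀

    -- The four classes contain all 2 N vertices, so their joint bound follows without an entry in
    -- `Balanced`.
    excess-zero : ∀ x → excess x 0F +ᶻ (excess x 1F +ᶻ (excess x 2F +ᶻ excess x 3F)) ≡ 0ℤ
    excess-zero (u , v , w) = cancel u v w
      where
      cancel : ∀ u v w → (u -ᶻ w) +ᶻ ((+ 2 *ᶻ v +ᶻ w -ᶻ u) +ᶻ ((w -ᶻ + 2 *ᶻ v +ᶻ u) +ᶻ (-ᶻ w -ᶻ u))) ≡ 0ℤ
      cancel = ℤ-Solver.solve-∀

    fits : Fits
    fits = let (b₀ , b₁ , b₂ , b₃) , (b₀₁ , b₁₂ , b₂₃) , (b₀₁₂ , b₁₂₃) = balanced in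
      (capacity n₀ b₀ , capacity n₁ b₁ , capacity n₂ b₂ , capacity n₃ b₃) ,
      (capacity (n₀ ⊕ n₁) b₀₁ , capacity (n₁ ⊕ n₂) b₁₂ , capacity (n₂ ⊕ n₃) b₂₃) ,
      (capacity (n₀ ⊕ n₁ ⊕ n₂) (subst (_≤ᶻ + 3) (ℤ.+-assoc (d 0F) (d 1F) (d 2F)) b₀₁₂) ,
       capacity (n₁ ⊕ n₂ ⊕ n₃) (subst (_≤ᶻ + 3) (ℤ.+-assoc (d 1F) (d 2F) (d 3F)) b₁₂₃)) ,
      capacity (n₀ ⊕ n₁ ⊕ n₂ ⊕ n₃) (subst (_≤ᶻ + 3) (sym (excess-zero (state H))) (+≤+ z≤n))
      where
      d = excess (state H)
      n₀ = class-load 0F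
      n₁ = class-load 1F
      n₂ = class-load 2F
      n₃ = class-load 3F

    -- At H-degree k the edges contribute 3 + k t, so a vertex label 1 + p - k t yields weight 4 +
    -- p; by `place-lower` the subtraction is exact.
    assign : V G ⊎ E G → ℕ
    assign (inj₁ v) = suc (place v ∸ deg H v * t)
    assign (inj₂ e) = 1 + bit (H e) * t

    labeling : TotalLabeling G (suc t)
    labeling = record { label = assign ; label-pos = pos ; label-≤ = upper }
      where
      pos : ∀ x → 1 ≤ assign x
      pos (inj₁ v) = s≤s z≤n
      pos (inj₂ e) = s≤s z≤n
      upper : ∀ x → assign x ≤ suc t
      upper (inj₁ v) = s≤s (ℕ.m≤n+o⇒m∸n≤o (place v) (deg H v * t) (place-upper fits v (total≤3 (H ∘ edge v))))
      upper (inj₂ e) with H e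
      ... | true  = s≤s (ℕ.≤-reflexive (ℕ.*-identityˡ t))
      ... | false = s≤s z≤n

    weight-place : ∀ v → weight labeling v ≡ 4 + place v
    weight-place v = begin
      suc (place v ∸ deg H v * t) + List.sum (map (λ e → assign (inj₂ e)) (incidentEdges G v))
        ≡⟨ cong (λ x → suc (place v ∸ deg H v * t) + x)
             (sum-triple (λ e → assign (inj₂ e)) (incidentEdges G v) (sym (cubic v))) ⟩
      suc (place v ∸ deg H v * t) + (assign (inj₂ (edge v 0F)) + (assign (inj₂ (edge v 1F)) + assign (inj₂ (edge v 2F))))
        ≡⟨ regroup (place v ∸ deg H v * t) (bit (H (edge v 0F))) (bit (H (edge v 1F))) (bit (H (edge v 2F))) t ⟩
      4 + (place v ∸ deg H v * t + deg H v * t)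
        ≡⟨ cong (λ p → 4 + p) (ℕ.m∸n+n≡m (place-lower v)) ⟩
      4 + place v ∎
      where
      open ≡-Reasoning
      regroup : ∀ p a b c t → suc p + ((1 + a * t) + ((1 + b * t) + (1 + c * t))) ≡ 4 + (p + (a + b + c) * t)
      regroup = ℕ-Solver.solve-∀

    irregular : VertexIrregular labeling
    irregular u v u≢v eq = u≢v (place-injective (ℕ.+-cancelˡ-≡ 4 _ _
      (trans (sym (weight-place u)) (trans eq (weight-place v)))))

    two-valued : ∀ e → edgeLabel labeling e ≡ 1 ⊎ edgeLabel labeling e ≡ suc t
    two-valued e with H e
    ... | true  = inj₂ (cong suc (ℕ.*-identityˡ t))
    ... | false = inj₁ refl

  two-valued-labeling : Σ[ ℓ ∈ TotalLabeling G (suc t) ]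
    (VertexIrregular ℓ × (∀ e → edgeLabel ℓ e ≡ 1 ⊎ edgeLabel ℓ e ≡ suc t))
  two-valued-labeling = labeling , irregular , two-valued
    where open Balance (proj₁ balanced-subgraph) (proj₂ balanced-subgraph)

  module _ {k : ℕ} (ℓ : TotalLabeling G k) where
    open TotalLabeling ℓ using (label; label-pos; label-≤; vertexLabel)

    weight-triple : ∀ v → weight ℓ v ≡
      vertexLabel v + (edgeLabel ℓ (edge v 0F) + (edgeLabel ℓ (edge v 1F) + edgeLabel ℓ (edge v 2F)))
    weight-triple v = cong (λ x → vertexLabel v + x) (sum-triple (edgeLabel ℓ) (incidentEdges G v) (sym (cubic v)))

    weight-lower : ∀ v → 4 ≤ weight ℓ v
    weight-lower v = subst (4 ≤_) (sym (weight-triple v))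
      (ℕ.+-mono-≤ (label-pos _) (ℕ.+-mono-≤ (label-pos _) (ℕ.+-mono-≤ (label-pos _) (label-pos _))))

    weight-upper : ∀ v → weight ℓ v ≤ 4 * k
    weight-upper v = subst₂ _≤_ (sym (weight-triple v)) (cong (λ x → k + (k + (k + x))) (sym (ℕ.+-identityʳ k)))
      (ℕ.+-mono-≤ (label-≤ _) (ℕ.+-mono-≤ (label-≤ _) (ℕ.+-mono-≤ (label-≤ _) (label-≤ _))))

    order≤4k-3 : 1 ≤ k → VertexIrregular ℓ → order + 3 ≤ 4 * k
    order≤4k-3 1≤k irregular = ℕ.≮⇒≥ λ 4k<n+3 →
      let i , j , i<j , eq = Fin.pigeonhole (many 4k<n+3) slot in
      irregular i j (Fin.<⇒≢ i<j) (ℕ.∸-cancelʳ-≡ (weight-lower i) (weight-lower j) (Fin.fromℕ<-injective _ _ _ _ eq))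
      where
      many : 4 * k < order + 3 → 4 * k ∸ 3 < order
      many 4k<n+3 = ℕ.+-cancelʳ-< 3 _ _ (subst (_< order + 3) (sym (ℕ.m∸n+n≡m 3≤4k)) 4k<n+3)
        where
        -- Here `1 ≤ k` keeps `4 * k ∸ 3`, the number of possible weights, from being truncated.
        3≤4k : 3 ≤ 4 * k
        3≤4k = ℕ.≤-trans (ℕ.n≤1+n 3) (ℕ.*-monoʳ-≤ 4 1≤k)
      slot : V G → Fin (4 * k ∸ 3)
      slot v = fromℕ< {m = weight ℓ v ∸ 4}
        (subst (_≤ 4 * k ∸ 3) (ℕ.+-∸-assoc 1 (weight-lower v)) (ℕ.∸-monoˡ-≤ 3 (weight-upper v)))

  -- From n + 3 ≤ 4 k follows n + 6 < 4 (k + 1), so the rounded quotient is below k + 1.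
  strength-lower : ∀ k → 1 ≤ k → HasVertexIrregularLabeling G k → ⌈ (order + 3) / 4 ⌉ ≤ k
  strength-lower k 1≤k (ℓ , irregular) = s≤s⁻¹ (m<n*o⇒m/o<n {order + 3 + 3} {suc k} {4} (begin-strict
    order + 3 + 3    ≤⟨ ℕ.+-monoˡ-≤ 3 (order≤4k-3 ℓ 1≤k irregular) ⟩
    4 * k + 3        <⟨ ℕ.≤-reflexive (shuffle k) ⟩
    suc k * 4        ∎))
    where
    open ℕ.≤-Reasoning
    shuffle : ∀ k → suc (4 * k + 3) ≡ suc k * 4
    shuffle = ℕ-Solver.solve-∀

theorem1p2 : (G : Graph) → Cubic G →
    let s = ⌈ (Graph.order G + 3) / 4 ⌉ in
    IsTvs G s
    × (Σ[ ℓ ∈ TotalLabeling G s ]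
    (VertexIrregular ℓ × (∀ (e : E G) → edgeLabel ℓ e ≡ 1 ⊎ edgeLabel ℓ e ≡ s)))
theorem1p2 G cubic = (1≤s , (proj₁ found , proj₁ (proj₂ found)) , strength-lower) , found
  where
  open Strength G cubic
  1≤s = subst (1 ≤_) (sym s≡1+t) (s≤s z≤n)
  found = subst
    (λ s → Σ[ ℓ ∈ TotalLabeling G s ] (VertexIrregular ℓ × (∀ e → edgeLabel ℓ e ≡ 1 ⊎ edgeLabel ℓ e ≡ s)))
    (sym s≡1+t) two-valued-labeling
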